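{- For every integer $n\geq 1$, $$N_{n}(t)=\left(\frac{1+yt}{1+y}\right)^{n+1}P^{(\mathrm{pk},\mathrm{des})}\left(\mathrm{Av}_{n}(231);\frac{(1+y)^{2}t}{(y+t)(1+yt)},\frac{y+t}{1+yt}\right).$$ Equivalently, $$P^{(\mathrm{pk},\mathrm{des})}(\mathrm{Av}_{n}(231);y,t)=\left(\frac{1+u}{1+uv}\right)^{n+1}N_{n}(v),$$ where $$u=\frac{1+t^{2}-2yt-(1-t)\sqrt{(1+t)^{2}-4yt}}{2(1-y)t},\qquad v=\frac{(1+t)^{2}-2yt-(1+t)\sqrt{(1+t)^{2}-4yt}}{2yt}.$$
   Context: $\mathfrak{S}_n$ is the set of permutations $\pi=\pi_1\cdots\pi_n$ of $[n]=\{1,\dots,n\}$. For $\pi\in\mathfrak{S}_n$, $\mathrm{des}(\pi)$ is the number of $i\in[n-1]$ with $\pi_i>\pi_{i+1}$, and $\mathrm{pk}(\pi)$ is the number of $i$ with $2\le i\le n-1$ and $\pi_{i-1}<\pi_i>\pi_{i+1}$. $\mathrm{Av}_n(231)$ is the set of $231$-avoiding permutations in $\mathfrak{S}_n$, i.e. those for which there are no $i<j<k$ with $\pi_k<\pi_i<\pi_j$. For $\Pi\subseteq\mathfrak{S}_n$, $P^{(\mathrm{pk},\mathrm{des})}(\Pi;y,t)=\sum_{\pi\in\Pi}y^{\mathrm{pk}(\pi)+1}t^{\mathrm{des}(\pi)+1}$. The $n$th Narayana polynomial is $N_n(t)=\sum_{\pi\in\mathrm{Av}_n(231)}t^{\mathrm{des}(\pi)+1}=\frac1n\sum_{k=1}^n\binom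 nk\binom n{k-1}t^k$ for $n\ge1$ (the equality of these two expressions is a known fact). Here $y,t$ are indeterminates; the first identity is an identity of rational functions in $y,t$. In the second identity, $\sqrt{(1+t)^2-4yt}$ is the formal power series in $t$ over $\mathbb{Q}[y]$ with constant term $1$, so that $u$ and $v$ are formal power series in $t$ with coefficients in $\mathbb{Q}[y]$. -}

module Defs where

open import Algebra.Bundles using (CommutativeRing)
import Algebra.Definitions
import Algebra.Properties.Semiring.Exp
import Algebra.Solver.Ring.NaturalCoefficients.Default
import Algebra.Properties.CommutativeSemigroup
import Algebra.Properties.Monoid.Sum
import Algebra.Properties.Ring
open import Data.Bool.Base using (if_then_else_)
open import Data.Fin.Base using (Fin; zero; suc; toℕ; fromℕ; inject₁; _<_)
import Data.Fin.Properties as Fin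
open import Data.List.Base using (List; []; _∷_; map; foldr; filter; allFin; cartesianProductWith)
open import Data.Nat.Base as ℕ using (ℕ; zero; suc; _∸_; z≤n; s≤s)
import Data.Nat.Properties as ℕ
open import Data.Product.Base using (∃; _×_; _,_; proj₁; proj₂)
open import Data.Rational.Base as ℚ using (ℚ; 0ℚ; ½; 1/_)
import Data.Rational.Properties as ℚ
open import Data.Sum.Base using (_⊎_; inj₁; inj₂)
open import Data.Vec.Base using (Vec; []; _∷_; lookup)
open import Level using (Level; _⊔_; 0ℓ)
open import Relation.Binary.PropositionalEquality as ≡ using (_≡_; _≢_)
import Relation.Binary.Reasoning.Setoid
open import Relation.Nullary.Decidable using (Dec; does; ¬?; _×-dec_; _→-dec_; decidable-stable)
open import Relation.Nullary.Negation using (¬_; contradiction)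
open import Relation.Nullary.Negation.Core using (Stable)

private
  variable
    c ℓ : Level
    k n : ℕ

-- One-line notation π₁⋯πₖ in the alphabet [n], with letters and
-- positions indexed from 0.
Word : ℕ → ℕ → Set
Word n k = Vec (Fin n) k

des : Word n k → ℕ
des []          = 0
des (_ ∷ [])    = 0
des (a ∷ b ∷ w) = (if does (b Fin.<? a) then 1 else 0) ℕ.+ des (b ∷ w)

pk : Word n k → ℕ
pk []              = 0
pk (_ ∷ [])        = 0
pk (_ ∷ _ ∷ [])    = 0
pk (a ∷ b ∷ d ∷ w) =
  (if does ((a Fin.<? b) ×-dec (d Fin.<? b)) then 1 else 0) ℕ.+ pk (b ∷ d ∷ w)

IsPermutation : Word n n → Set
IsPermutation π = ∀ i j → lookup π i ≡ lookup π j → i ≡ j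

isPermutation? : (π : Word n n) → Dec (IsPermutation π)
isPermutation? π = Fin.all? λ i → Fin.all? λ j →
  (lookup π i Fin.≟ lookup π j) →-dec (i Fin.≟ j)

Contains231 : Word n k → Set
Contains231 π = ∃ λ i → ∃ λ j → ∃ λ l →
  (i < j) × (j < l) × (lookup π l < lookup π i) × (lookup π i < lookup π j)

contains231? : (π : Word n k) → Dec (Contains231 π)
contains231? π = Fin.any? λ i → Fin.any? λ j → Fin.any? λ l →
  (i Fin.<? j) ×-dec (j Fin.<? l) ×-dec
  (lookup π l Fin.<? lookup π i) ×-dec (lookup π i Fin.<? lookup π j)

-- All words, each listed exactly once; so 𝔖 n and Av231 n below are
-- finite sets given as duplicate-free lists.
words : ∀ n k → List (Word n k)
words n zero    = [] ∷ []
words n (suc k) = cartesianProductWith _∷_ (allFin n) (words n k)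

𝔖 : ∀ n → List (Word n n)
𝔖 n = filter isPermutation? (words n n)

Av231 : ∀ n → List (Word n n)
Av231 n = filter (λ π → ¬? (contains231? π)) (𝔖 n)

module Enumerators (R : CommutativeRing c ℓ) where
  open CommutativeRing R
  open Algebra.Properties.Semiring.Exp semiring using (_^_)

  ∑ : {A : Set} → List A → (A → Carrier) → Carrier
  ∑ xs f = foldr _+_ 0# (map f xs)

  -- The generating polynomials below are evaluated at elements of R; taking
  -- for y and t the indeterminates of a ring R of polynomials, rational
  -- functions or series gives the polynomials themselves.
  P⁽ᵖᵏ,ᵈᵉˢ⁾ : List (Word n n) → Carrier → Carrier → Carrier
  P⁽ᵖᵏ,ᵈᵉˢ⁾ Π y t = ∑ Π λ π → y ^ (pk π ℕ.+ 1) * t ^ (des π ℕ.+ 1)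

  Narayana : ℕ → Carrier → Carrier
  Narayana n t = ∑ (Av231 n) λ π → t ^ (des π ℕ.+ 1)

module PowerSeries (R : CommutativeRing c ℓ) where
  open CommutativeRing R
  open Algebra.Properties.Monoid.Sum +-monoid
  open Algebra.Properties.Ring ring
  open Algebra.Properties.CommutativeSemigroup +-commutativeSemigroup using (interchange)
  open Relation.Binary.Reasoning.Setoid setoid

  Series : Set c
  Series = ℕ → Carrier

  infix 4 _≈ˢ_
  _≈ˢ_ : Series → Series → Set ℓ
  f ≈ˢ g = ∀ n → f n ≈ g n

  infixl 6 _+ˢ_
  infixl 7 _*ˢ_

  _+ˢ_ _*ˢ_ : Series → Series → Series
  (f +ˢ g) n = f n + g n
  (f *ˢ g) n = ∑[ i ≤ n ] (f (toℕ i) * g (n ∸ toℕ i))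

  -ˢ_ : Series → Series
  (-ˢ f) n = - f n

  const : Carrier → Series
  const a zero    = a
  const a (suc _) = 0#

  X : Series
  X (suc zero) = 1#
  X _          = 0#

  0ˢ 1ˢ : Series
  0ˢ _ = 0#
  1ˢ   = const 1#

  tail : Series → Series
  tail f n = f (suc n)

  private
    scale : Carrier → Series → Series
    scale a f n = a * f n

    ∑-zero : ∀ n (t : Fin n → Carrier) → (∀ i → t i ≈ 0#) → sum t ≈ 0#
    ∑-zero n t t≈0 = trans (sum-cong-≋ t≈0) (sum-replicate-zero n)

  *ˢ-zero : ∀ f g → (f *ˢ g) 0 ≈ f 0 * g 0
  *ˢ-zero f g = +-identityʳ _

  *ˢ-suc : ∀ f g n → (f *ˢ g) (suc n) ≡ f 0 * g (suc n) + (tail f *ˢ g) n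
  *ˢ-suc f g n = ≡.refl

  *ˢ-sucʳ : ∀ f g n → (f *ˢ g) (suc n) ≈ f (suc n) * g 0 + (f *ˢ tail g) n
  *ˢ-sucʳ f g zero    = begin
    f 0 * g 1 + (tail f *ˢ g) 0    ≈⟨ +-congˡ (*ˢ-zero (tail f) g) ⟩
    f 0 * g 1 + f 1 * g 0          ≈⟨ +-comm _ _ ⟩
    f 1 * g 0 + f 0 * g 1          ≈⟨ +-congˡ (*ˢ-zero f (tail g)) ⟨
    f 1 * g 0 + (f *ˢ tail g) 0    ∎
  *ˢ-sucʳ f g (suc n) = begin
    a + (tail f *ˢ g) (suc n)             ≈⟨ +-congˡ (*ˢ-sucʳ (tail f) g n) ⟩
    a + (b + (tail f *ˢ tail g) n)        ≈⟨ +-assoc a b _ ⟨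
    a + b + (tail f *ˢ tail g) n          ≈⟨ +-congʳ (+-comm a b) ⟩
    b + a + (tail f *ˢ tail g) n          ≈⟨ +-assoc b a _ ⟩
    b + (a + (tail f *ˢ tail g) n)        ∎
    where
    a = f 0 * g (suc (suc n))
    b = f (suc (suc n)) * g 0

  *ˢ-cong : ∀ {f f′ g g′} → f ≈ˢ f′ → g ≈ˢ g′ → f *ˢ g ≈ˢ f′ *ˢ g′
  *ˢ-cong f≈ g≈ n = sum-cong-≋ {suc n} λ i → *-cong (f≈ (toℕ i)) (g≈ (n ∸ toℕ i))

  *ˢ-comm : ∀ f g → f *ˢ g ≈ˢ g *ˢ f
  *ˢ-comm f g zero    = +-congʳ (*-comm _ _)
  *ˢ-comm f g (suc n) = begin
    f 0 * g (suc n) + (tail f *ˢ g) n    ≈⟨ +-cong (*-comm _ _) (*ˢ-comm (tail f) g n) ⟩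
    g (suc n) * f 0 + (g *ˢ tail f) n    ≈⟨ *ˢ-sucʳ g f n ⟨
    (g *ˢ f) (suc n)                     ∎

  *ˢ-distribʳ : ∀ h f g → (f +ˢ g) *ˢ h ≈ˢ f *ˢ h +ˢ g *ˢ h
  *ˢ-distribʳ h f g zero    = begin
    (f 0 + g 0) * h 0 + 0#                  ≈⟨ +-cong (distribʳ _ _ _) (sym (+-identityʳ 0#)) ⟩
    f 0 * h 0 + g 0 * h 0 + (0# + 0#)       ≈⟨ interchange _ _ _ _ ⟩
    (f 0 * h 0 + 0#) + (g 0 * h 0 + 0#)     ∎
  *ˢ-distribʳ h f g (suc n) = begin
    (f 0 + g 0) * h (suc n) + (tail (f +ˢ g) *ˢ h) n
      ≈⟨ +-cong (distribʳ _ _ _) (*ˢ-distribʳ h (tail f) (tail g) n) ⟩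
    (f 0 * h (suc n) + g 0 * h (suc n)) + ((tail f *ˢ h) n + (tail g *ˢ h) n)
      ≈⟨ interchange _ _ _ _ ⟩
    (f *ˢ h) (suc n) + (g *ˢ h) (suc n) ∎

  *ˢ-distribˡ : ∀ h f g → h *ˢ (f +ˢ g) ≈ˢ h *ˢ f +ˢ h *ˢ g
  *ˢ-distribˡ h f g n = begin
    (h *ˢ (f +ˢ g)) n          ≈⟨ *ˢ-comm h (f +ˢ g) n ⟩
    ((f +ˢ g) *ˢ h) n          ≈⟨ *ˢ-distribʳ h f g n ⟩
    (f *ˢ h) n + (g *ˢ h) n    ≈⟨ +-cong (*ˢ-comm f h n) (*ˢ-comm g h n) ⟩
    (h *ˢ f) n + (h *ˢ g) n    ∎

  private
    scale-*ˢ : ∀ a f g → scale a f *ˢ g ≈ˢ scale a (f *ˢ g)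
    scale-*ˢ a f g zero    = begin
      a * f 0 * g 0 + 0#         ≈⟨ +-cong (*-assoc a _ _) (sym (zeroʳ a)) ⟩
      a * (f 0 * g 0) + a * 0#   ≈⟨ distribˡ a _ _ ⟨
      a * (f 0 * g 0 + 0#)       ∎
    scale-*ˢ a f g (suc n) = begin
      a * f 0 * g (suc n) + (scale a (tail f) *ˢ g) n
        ≈⟨ +-cong (*-assoc a _ _) (scale-*ˢ a (tail f) g n) ⟩
      a * (f 0 * g (suc n)) + a * (tail f *ˢ g) n
        ≈⟨ distribˡ a _ _ ⟨
      a * (f *ˢ g) (suc n) ∎

  *ˢ-assoc : ∀ f g h → (f *ˢ g) *ˢ h ≈ˢ f *ˢ (g *ˢ h)
  *ˢ-assoc f g h zero    = +-congʳ (begin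
    (f 0 * g 0 + 0#) * h 0     ≈⟨ *-congʳ (+-identityʳ _) ⟩
    f 0 * g 0 * h 0            ≈⟨ *-assoc _ _ _ ⟩
    f 0 * (g 0 * h 0)          ≈⟨ *-congˡ (+-identityʳ _) ⟨
    f 0 * (g 0 * h 0 + 0#)     ∎)
  *ˢ-assoc f g h (suc n) = begin
    (f *ˢ g) 0 * h (suc n) + (tail (f *ˢ g) *ˢ h) n
      ≈⟨ +-cong (*-congʳ (*ˢ-zero f g)) (*ˢ-distribʳ h (scale (f 0) (tail g)) (tail f *ˢ g) n) ⟩
    f 0 * g 0 * h (suc n) + ((scale (f 0) (tail g) *ˢ h) n + ((tail f *ˢ g) *ˢ h) n)
      ≈⟨ +-cong (*-assoc _ _ _) (+-cong (scale-*ˢ (f 0) (tail g) h n) (*ˢ-assoc (tail f) g h n)) ⟩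
    f 0 * (g 0 * h (suc n)) + (f 0 * (tail g *ˢ h) n + (tail f *ˢ (g *ˢ h)) n)
      ≈⟨ +-assoc _ _ _ ⟨
    f 0 * (g 0 * h (suc n)) + f 0 * (tail g *ˢ h) n + (tail f *ˢ (g *ˢ h)) n
      ≈⟨ +-congʳ (distribˡ _ _ _) ⟨
    (f *ˢ (g *ˢ h)) (suc n) ∎

  *ˢ-identityˡ : ∀ f → 1ˢ *ˢ f ≈ˢ f
  *ˢ-identityˡ f n = begin
    1# * f n + sum {n} _   ≈⟨ +-cong (*-identityˡ _) (∑-zero n _ λ i → zeroˡ (f (n ∸ suc (toℕ i)))) ⟩
    f n + 0#               ≈⟨ +-identityʳ _ ⟩
    f n                    ∎

  *ˢ-identityʳ : ∀ f → f *ˢ 1ˢ ≈ˢ f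
  *ˢ-identityʳ f n = trans (*ˢ-comm f 1ˢ n) (*ˢ-identityˡ f n)

  seriesRing : CommutativeRing c ℓ
  seriesRing = record
    { Carrier = Series
    ; _≈_ = _≈ˢ_
    ; _+_ = _+ˢ_
    ; _*_ = _*ˢ_
    ; -_ = -ˢ_
    ; 0# = 0ˢ
    ; 1# = 1ˢ
    ; isCommutativeRing = record
      { isRing = record
        { +-isAbelianGroup = record
          { isGroup = record
            { isMonoid = record
              { isSemigroup = record
                { isMagma = record
                  { isEquivalence = record
                    { refl = λ n → refl
                    ; sym = λ p n → sym (p n)
                    ; trans = λ p q n → trans (p n) (q n)
                    }
                  ; ∙-cong = λ p q n → +-cong (p n) (q n)
                  }
                ; assoc = λ f g h n → +-assoc (f n) (g n) (h n)
                }
              ; identity = (λ f n → +-identityˡ (f n)) , (λ f n → +-identityʳ (f n))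
              }
            ; inverse = (λ f n → -‿inverseˡ (f n)) , (λ f n → -‿inverseʳ (f n))
            ; ⁻¹-cong = λ p n → -‿cong (p n)
            }
          ; comm = λ f g n → +-comm (f n) (g n)
          }
        ; *-cong = *ˢ-cong
        ; *-assoc = *ˢ-assoc
        ; *-identity = *ˢ-identityˡ , *ˢ-identityʳ
        ; distrib = *ˢ-distribˡ , *ˢ-distribʳ
        }
      ; *-comm = *ˢ-comm
      }
    }

  radicand-constant : ∀ b → ((1ˢ +ˢ X) *ˢ (1ˢ +ˢ X) +ˢ (-ˢ (b *ˢ X))) 0 ≈ 1#
  radicand-constant b = begin
    ((1ˢ +ˢ X) *ˢ (1ˢ +ˢ X)) 0 - (b *ˢ X) 0
      ≈⟨ +-cong (*ˢ-zero (1ˢ +ˢ X) (1ˢ +ˢ X)) (-‿cong (*ˢ-zero b X)) ⟩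
    (1# + 0#) * (1# + 0#) - b 0 * 0#
      ≈⟨ +-cong (*-cong (+-identityʳ 1#) (+-identityʳ 1#)) (-‿cong (zeroʳ (b 0))) ⟩
    1# * 1# - 0#
      ≈⟨ +-cong (*-identityˡ 1#) -0#≈0# ⟩
    1# + 0#
      ≈⟨ +-identityʳ 1# ⟩
    1# ∎

  -- The square root with constant term 1 of a series f with constant
  -- term 1: the coefficient of Xⁿ⁺¹ in s² = f reads
  -- 2 sₙ₊₁ + Σ_{0<i<n+1} sᵢ sₙ₊₁₋ᵢ = fₙ₊₁.
  module SquareRoot (half : Carrier) (half+half≈1 : half + half ≈ 1#) where

    step : Series → Series → Series
    step f s zero    = 1#
    step f s (suc n) = half * (f (suc n) - ∑[ i < n ] (s (suc (toℕ i)) * s (n ∸ toℕ i)))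

    approximation : Series → ℕ → Series
    approximation f zero    = 0ˢ
    approximation f (suc m) = step f (approximation f m)

    √ : Series → Series
    √ f n = approximation f (suc n) n

    private
      step-cong : ∀ f s s′ n → (∀ i → i ℕ.< n → s i ≈ s′ i) → step f s n ≈ step f s′ n
      step-cong f s s′ zero    p = refl
      step-cong f s s′ (suc n) p = *-congˡ (+-congˡ (-‿cong (sum-cong-≋ {n} λ i →
        *-cong (p (suc (toℕ i)) (s≤s (Fin.toℕ<n i))) (p (n ∸ toℕ i) (s≤s (ℕ.m∸n≤m n (toℕ i)))))))

      stable-suc : ∀ f m i → i ℕ.< m → approximation f (suc m) i ≈ approximation f m i
      stable-suc f (suc m) i (s≤s i≤m) = step-cong f _ _ i λ j j<i →
        stable-suc f m j (ℕ.<-≤-trans j<i i≤m)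

      stable : ∀ f m i → i ℕ.< m → approximation f m i ≈ √ f i
      stable f (suc m) i (s≤s i≤m) with ℕ.m≤n⇒m<n∨m≡n i≤m
      ... | inj₁ i<m    = trans (stable-suc f m i i<m) (stable f m i i<m)
      ... | inj₂ ≡.refl = refl

      √-fixed : ∀ f → √ f ≈ˢ step f (√ f)
      √-fixed f n = step-cong f _ _ n (stable f n)

    √-constant : ∀ f → √ f 0 ≈ 1#
    √-constant f = refl

    √-square : ∀ f → f 0 ≈ 1# → √ f *ˢ √ f ≈ˢ f
    √-square f f₀≈1 zero    = begin
      1# * 1# + 0#   ≈⟨ +-identityʳ _ ⟩
      1# * 1#        ≈⟨ *-identityˡ _ ⟩
      1#             ≈⟨ f₀≈1 ⟨
      f 0            ∎
    √-square f f₀≈1 (suc n) = begin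
      1# * s (suc n) + (tail s *ˢ s) n   ≈⟨ +-cong (*-identityˡ _) (split n) ⟩
      s (suc n) + (M + s (suc n) * 1#)   ≈⟨ +-congˡ (+-congˡ (*-identityʳ _)) ⟩
      s (suc n) + (M + s (suc n))        ≈⟨ +-congˡ (+-comm _ _) ⟩
      s (suc n) + (s (suc n) + M)        ≈⟨ +-assoc _ _ _ ⟨
      s (suc n) + s (suc n) + M          ≈⟨ +-congʳ (+-cong (√-fixed f (suc n)) (√-fixed f (suc n))) ⟩
      half * d + half * d + M            ≈⟨ +-congʳ (distribʳ d half half) ⟨
      (half + half) * d + M              ≈⟨ +-congʳ (*-congʳ half+half≈1) ⟩
      1# * d + M                         ≈⟨ +-congʳ (*-identityˡ d) ⟩
      f (suc n) - M + M                  ≈⟨ +-assoc _ _ _ ⟩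
      f (suc n) + (- M + M)              ≈⟨ +-congˡ (-‿inverseˡ M) ⟩
      f (suc n) + 0#                     ≈⟨ +-identityʳ _ ⟩
      f (suc n)                          ∎
      where
      s = √ f
      M = ∑[ i < n ] (s (suc (toℕ i)) * s (n ∸ toℕ i))
      d = f (suc n) - M

      last-term : ∀ n (t : ℕ → Carrier) → ∑[ i ≤ n ] t (toℕ i) ≈ ∑[ i < n ] t (toℕ i) + t n
      last-term zero    t = +-comm _ _
      last-term (suc n) t = trans (+-congˡ (last-term n (λ i → t (suc i)))) (sym (+-assoc _ _ _))

      split : ∀ n → (tail s *ˢ s) n ≈ ∑[ i < n ] (s (suc (toℕ i)) * s (n ∸ toℕ i)) + s (suc n) * 1#
      split n = trans (last-term n (λ i → s (suc i) * s (n ∸ i)))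
        (+-congˡ (*-congˡ (reflexive (≡.cong s (ℕ.n∸n≡0 n)))))

-- Polynomials are the series with finitely many non-zero coefficients.
module Polynomials (R : CommutativeRing c ℓ) where
  open CommutativeRing R
  open Algebra.Properties.Monoid.Sum +-monoid
  open Algebra.Properties.Ring ring
  private
    module S = PowerSeries R
    module SR = CommutativeRing S.seriesRing
  open S using (_≈ˢ_; _+ˢ_; _*ˢ_; -ˢ_)

  record Polynomial : Set (c ⊔ ℓ) where
    field
      coefficient : ℕ → Carrier
      bound       : ℕ
      vanishing   : ∀ n → bound ℕ.≤ n → coefficient n ≈ 0#

  open Polynomial public

  infix 4 _≈ᵖ_
  _≈ᵖ_ : Polynomial → Polynomial → Set ℓ
  p ≈ᵖ q = coefficient p ≈ˢ coefficient q

  const : Carrier → Polynomial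
  const a = record { coefficient = S.const a ; bound = 1 ; vanishing = van }
    where
    van : ∀ n → 1 ℕ.≤ n → S.const a n ≈ 0#
    van (suc n) _ = refl

  X : Polynomial
  X = record { coefficient = S.X ; bound = 2 ; vanishing = van }
    where
    van : ∀ n → 2 ℕ.≤ n → S.X n ≈ 0#
    van (suc (suc n)) _ = refl
    van (suc zero) (s≤s ())

  infixl 6 _+ᵖ_
  infixl 7 _*ᵖ_

  _+ᵖ_ _*ᵖ_ : Polynomial → Polynomial → Polynomial
  p +ᵖ q = record
    { coefficient = coefficient p +ˢ coefficient q
    ; bound       = bound p ℕ.⊔ bound q
    ; vanishing   = λ n ≤n → trans
        (+-cong (vanishing p n (ℕ.≤-trans (ℕ.m≤m⊔n _ _) ≤n))
                (vanishing q n (ℕ.≤-trans (ℕ.m≤n⊔m (bound p) _) ≤n)))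
        (+-identityˡ 0#)
    }
  p *ᵖ q = record
    { coefficient = coefficient p *ˢ coefficient q
    ; bound       = bound p ℕ.+ bound q
    ; vanishing   = λ n ≤n → trans
        (sum-cong-≋ {suc n} λ i → term n ≤n (toℕ i))
        (sum-replicate-zero (suc n))
    }
    where
    term : ∀ n → bound p ℕ.+ bound q ℕ.≤ n → ∀ i →
           coefficient p i * coefficient q (n ∸ i) ≈ 0#
    term n ≤n i with ℕ.≤-total (bound p) i
    ... | inj₁ p≤i = trans (*-congʳ (vanishing p i p≤i)) (zeroˡ _)
    ... | inj₂ i≤p = trans (*-congˡ (vanishing q (n ∸ i) q≤n∸i)) (zeroʳ _)
      where
      q≤n∸i : bound q ℕ.≤ n ∸ i
      q≤n∸i = ℕ.≤-trans (ℕ.≤-reflexive (≡.sym (ℕ.m+n∸m≡n (bound p) (bound q))))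
                        (ℕ.∸-mono ≤n i≤p)

  -ᵖ_ : Polynomial → Polynomial
  -ᵖ p = record
    { coefficient = -ˢ coefficient p
    ; bound       = bound p
    ; vanishing   = λ n ≤n → trans (-‿cong (vanishing p n ≤n)) -0#≈0#
    }

  0ᵖ 1ᵖ : Polynomial
  0ᵖ = record { coefficient = S.0ˢ ; bound = 0 ; vanishing = λ _ _ → refl }
  1ᵖ = const 1#

  polynomialRing : CommutativeRing (c ⊔ ℓ) ℓ
  polynomialRing = record
    { Carrier = Polynomial
    ; _≈_ = _≈ᵖ_
    ; _+_ = _+ᵖ_
    ; _*_ = _*ᵖ_
    ; -_ = -ᵖ_
    ; 0# = 0ᵖ
    ; 1# = 1ᵖ
    ; isCommutativeRing = record
      { isRing = record
        { +-isAbelianGroup = record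
          { isGroup = record
            { isMonoid = record
              { isSemigroup = record
                { isMagma = record
                  { isEquivalence = record
                    { refl = λ n → refl
                    ; sym = λ p n → sym (p n)
                    ; trans = λ p q n → trans (p n) (q n)
                    }
                  ; ∙-cong = λ p q n → +-cong (p n) (q n)
                  }
                ; assoc = λ p q r → SR.+-assoc (coefficient p) (coefficient q) (coefficient r)
                }
              ; identity = (λ p → SR.+-identityˡ (coefficient p))
                         , (λ p → SR.+-identityʳ (coefficient p))
              }
            ; inverse = (λ p → SR.-‿inverseˡ (coefficient p))
                      , (λ p → SR.-‿inverseʳ (coefficient p))
            ; ⁻¹-cong = λ p n → -‿cong (p n)
            }
          ; comm = λ p q → SR.+-comm (coefficient p) (coefficient q)
          }
        ; *-cong = λ {p} {p′} {q} {q′} → S.*ˢ-cong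
            {coefficient p} {coefficient p′} {coefficient q} {coefficient q′}
        ; *-assoc = λ p q r → S.*ˢ-assoc (coefficient p) (coefficient q) (coefficient r)
        ; *-identity = (λ p → S.*ˢ-identityˡ (coefficient p))
                     , (λ p → S.*ˢ-identityʳ (coefficient p))
        ; distrib = (λ p q r → S.*ˢ-distribˡ (coefficient p) (coefficient q) (coefficient r))
                  , (λ p q r → S.*ˢ-distribʳ (coefficient p) (coefficient q) (coefficient r))
        }
      ; *-comm = λ p q → S.*ˢ-comm (coefficient p) (coefficient q)
      }
    }

-- ≈-stable is classically automatic. It is required here because equality
-- of series is undecidable, while "non-zero" means the negation of ≈ 0#.
record IntegralDomain (c ℓ : Level) : Set (Level.suc (c ⊔ ℓ)) where
  field
    commutativeRing : CommutativeRing c ℓ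
  open CommutativeRing commutativeRing public
  open Algebra.Definitions _≈_
  field
    1≉0              : ¬ 1# ≈ 0#
    *-cancelˡ-nonZero : AlmostLeftCancellative 0# _*_
    ≈-stable         : ∀ x y → Stable (x ≈ y)

  nonZero*zero : ∀ x y → ¬ x ≈ 0# → x * y ≈ 0# → y ≈ 0#
  nonZero*zero x y x≉0 xy≈0 =
    *-cancelˡ-nonZero x y 0# x≉0 (trans xy≈0 (sym (zeroʳ x)))

  *-nonZero : ∀ {x y} → ¬ x ≈ 0# → ¬ y ≈ 0# → ¬ x * y ≈ 0#
  *-nonZero x≉0 y≉0 xy≈0 = y≉0 (nonZero*zero _ _ x≉0 xy≈0)

module SeriesDomain (D : IntegralDomain c ℓ) where
  open IntegralDomain D
  open Algebra.Properties.Ring ring using (x∙y⁻¹≈ε⇒x≈y; -‿distribʳ-*)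
  open PowerSeries commutativeRing
  private
    module S = CommutativeRing seriesRing
    module SP = Algebra.Properties.Ring S.ring

    constantTerm : ∀ f g → ¬ f 0 ≈ 0# → f *ˢ g ≈ˢ 0ˢ → ∀ n → g n ≈ 0#
    constantTerm f g f₀≉0 fg≈0 zero    =
      nonZero*zero (f 0) (g 0) f₀≉0 (trans (sym (*ˢ-zero f g)) (fg≈0 0))
    constantTerm f g f₀≉0 fg≈0 (suc n) = constantTerm f (tail g) f₀≉0 shifted n
      where
      shifted : f *ˢ tail g ≈ˢ 0ˢ
      shifted m = trans (sym (+-identityˡ _)) (trans
        (+-congʳ (sym (trans (*-congˡ (constantTerm f g f₀≉0 fg≈0 0)) (zeroʳ _))))
        (trans (sym (*ˢ-sucʳ f g m)) (fg≈0 (suc m))))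

    someTerm : ∀ k f g → ¬ f k ≈ 0# → f *ˢ g ≈ˢ 0ˢ → ∀ n → g n ≈ 0#
    someTerm zero    f g fₖ≉0 fg≈0 n = constantTerm f g fₖ≉0 fg≈0 n
    someTerm (suc k) f g fₖ≉0 fg≈0 n = ≈-stable _ _ λ gₙ≉0 →
      gₙ≉0 (constantTerm f g (λ f₀≈0 → gₙ≉0 (someTerm k (tail f) g fₖ≉0 (shifted f₀≈0) n)) fg≈0 n)
      where
      shifted : f 0 ≈ 0# → tail f *ˢ g ≈ˢ 0ˢ
      shifted f₀≈0 m = trans (sym (+-identityˡ _)) (trans
        (+-congʳ (sym (trans (*-congʳ f₀≈0) (zeroˡ _)))) (fg≈0 (suc m)))

  noZeroDivisors : ∀ f g → ¬ f ≈ˢ 0ˢ → f *ˢ g ≈ˢ 0ˢ → g ≈ˢ 0ˢ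
  noZeroDivisors f g f≉0 fg≈0 n = ≈-stable _ _ λ gₙ≉0 →
    f≉0 λ k → ≈-stable _ _ λ fₖ≉0 → gₙ≉0 (someTerm k f g fₖ≉0 fg≈0 n)

  *ˢ-cancelˡ-nonZero : ∀ f g h → ¬ f ≈ˢ 0ˢ → f *ˢ g ≈ˢ f *ˢ h → g ≈ˢ h
  *ˢ-cancelˡ-nonZero f g h f≉0 fg≈fh n = x∙y⁻¹≈ε⇒x≈y (g n) (h n)
    (noZeroDivisors f (g +ˢ (-ˢ h)) f≉0 difference n)
    where
    difference : f *ˢ (g +ˢ (-ˢ h)) ≈ˢ 0ˢ
    difference m = trans (*ˢ-distribˡ f g (-ˢ h) m) (trans
      (+-cong (fg≈fh m) (sym (SP.-‿distribʳ-* f h m)))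
      (-‿inverseʳ ((f *ˢ h) m)))

  integralDomain : IntegralDomain c ℓ
  integralDomain = record
    { commutativeRing   = seriesRing
    ; 1≉0               = λ 1≈0 → 1≉0 (1≈0 0)
    ; *-cancelˡ-nonZero = *ˢ-cancelˡ-nonZero
    ; ≈-stable          = λ f g ¬¬f≈g n → ≈-stable _ _ λ fₙ≉gₙ → ¬¬f≈g λ f≈g → fₙ≉gₙ (f≈g n)
    }

module PolynomialDomain (D : IntegralDomain c ℓ) where
  private
    module D = IntegralDomain D
    module S = SeriesDomain D
  open Polynomials D.commutativeRing

  integralDomain : IntegralDomain (c ⊔ ℓ) ℓ
  integralDomain = record
    { commutativeRing   = polynomialRing
    ; 1≉0               = λ 1≈0 → D.1≉0 (1≈0 0)
    ; *-cancelˡ-nonZero = λ p q r →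
        S.*ˢ-cancelˡ-nonZero (coefficient p) (coefficient q) (coefficient r)
    ; ≈-stable          = λ p q →
        IntegralDomain.≈-stable S.integralDomain (coefficient p) (coefficient q)
    }

module Fractions (D : IntegralDomain c ℓ) where
  open IntegralDomain D
  open Algebra.Properties.Ring ring using (-‿distribˡ-*)
  open Relation.Binary.Reasoning.Setoid setoid
  open Algebra.Solver.Ring.NaturalCoefficients.Default commutativeSemiring
    using (solve; _:=_; _:+_; _:*_)

  record Fraction : Set (c ⊔ ℓ) where
    field
      numerator     : Carrier
      denominator   : Carrier
      denominator≉0 : ¬ denominator ≈ 0#

  open Fraction public

  infix 4 _≈ᶠ_
  _≈ᶠ_ : Fraction → Fraction → Set ℓ
  x ≈ᶠ y = numerator x * denominator y ≈ numerator y * denominator x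

  ι : Carrier → Fraction
  ι a = record { numerator = a ; denominator = 1# ; denominator≉0 = 1≉0 }

  infixl 6 _+ᶠ_
  infixl 7 _*ᶠ_

  _+ᶠ_ _*ᶠ_ : Fraction → Fraction → Fraction
  x +ᶠ y = record
    { numerator     = numerator x * denominator y + numerator y * denominator x
    ; denominator   = denominator x * denominator y
    ; denominator≉0 = *-nonZero (denominator≉0 x) (denominator≉0 y)
    }
  x *ᶠ y = record
    { numerator     = numerator x * numerator y
    ; denominator   = denominator x * denominator y
    ; denominator≉0 = *-nonZero (denominator≉0 x) (denominator≉0 y)
    }

  -ᶠ_ : Fraction → Fraction
  -ᶠ x = record
    { numerator     = - numerator x
    ; denominator   = denominator x
    ; denominator≉0 = denominator≉0 x
    }

  0ᶠ 1ᶠ : Fraction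
  0ᶠ = ι 0#
  1ᶠ = ι 1#

  ≈0⇒numerator≈0 : ∀ x → x ≈ᶠ 0ᶠ → numerator x ≈ 0#
  ≈0⇒numerator≈0 x x≈0 = trans (sym (*-identityʳ _)) (trans x≈0 (zeroˡ _))

  1+xy≈0⇒ : ∀ x y → 1ᶠ +ᶠ x *ᶠ y ≈ᶠ 0ᶠ →
    denominator x * denominator y + numerator x * numerator y ≈ 0#
  1+xy≈0⇒ x y p = trans
    (+-cong (sym (*-identityˡ _)) (sym (*-identityʳ _)))
    (≈0⇒numerator≈0 (1ᶠ +ᶠ x *ᶠ y) p)

  -- Field division; the proof in brackets says that the divisor is non-zero.
  infixl 7 _÷_[_]
  _÷_[_] : (x y : Fraction) → ¬ y ≈ᶠ 0ᶠ → Fraction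
  x ÷ y [ y≉0 ] = record
    { numerator     = numerator x * denominator y
    ; denominator   = denominator x * numerator y
    ; denominator≉0 = *-nonZero (denominator≉0 x) λ num≈0 →
        y≉0 (trans (*-identityʳ _) (trans num≈0 (sym (zeroˡ _))))
    }

  private
    ≈ᶠ-trans : ∀ x y z → x ≈ᶠ y → y ≈ᶠ z → x ≈ᶠ z
    ≈ᶠ-trans x y z p q = *-cancelˡ-nonZero d _ _ (denominator≉0 y) (begin
      d * (a * f)   ≈⟨ solve 3 (λ d a f → d :* (a :* f) := a :* d :* f) refl d a f ⟩
      a * d * f     ≈⟨ *-congʳ p ⟩
      e * b * f     ≈⟨ solve 3 (λ e b f → e :* b :* f := e :* f :* b) refl e b f ⟩
      e * f * b     ≈⟨ *-congʳ q ⟩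
      g * d * b     ≈⟨ solve 3 (λ g d b → g :* d :* b := d :* (g :* b)) refl g d b ⟩
      d * (g * b)   ∎)
      where
      a = numerator x
      b = denominator x
      e = numerator y
      d = denominator y
      g = numerator z
      f = denominator z

    +ᶠ-cong : ∀ x x′ y y′ → x ≈ᶠ x′ → y ≈ᶠ y′ → x +ᶠ y ≈ᶠ x′ +ᶠ y′
    +ᶠ-cong x x′ y y′ p q = begin
      (a * d + e * b) * (b′ * d′)
        ≈⟨ solve 6 (λ a b e d b′ d′ → (a :* d :+ e :* b) :* (b′ :* d′)
             := a :* b′ :* (d :* d′) :+ e :* d′ :* (b :* b′)) refl a b e d b′ d′ ⟩
      a * b′ * (d * d′) + e * d′ * (b * b′)
        ≈⟨ +-cong (*-congʳ p) (*-congʳ q) ⟩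
      a′ * b * (d * d′) + e′ * d * (b * b′)
        ≈⟨ solve 6 (λ a′ b′ e′ d′ b d → a′ :* b :* (d :* d′) :+ e′ :* d :* (b :* b′)
             := (a′ :* d′ :+ e′ :* b′) :* (b :* d)) refl a′ b′ e′ d′ b d ⟩
      (a′ * d′ + e′ * b′) * (b * d) ∎
      where
      a = numerator x
      b = denominator x
      e = numerator y
      d = denominator y
      a′ = numerator x′
      b′ = denominator x′
      e′ = numerator y′
      d′ = denominator y′

    *ᶠ-cong : ∀ x x′ y y′ → x ≈ᶠ x′ → y ≈ᶠ y′ → x *ᶠ y ≈ᶠ x′ *ᶠ y′
    *ᶠ-cong x x′ y y′ p q = begin
      (a * e) * (b′ * d′)     ≈⟨ shuffle a e b′ d′ ⟩
      (a * b′) * (e * d′)     ≈⟨ *-cong p q ⟩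
      (a′ * b) * (e′ * d)     ≈⟨ shuffle a′ b e′ d ⟩
      (a′ * e′) * (b * d)     ∎
      where
      a = numerator x
      b = denominator x
      e = numerator y
      d = denominator y
      a′ = numerator x′
      b′ = denominator x′
      e′ = numerator y′
      d′ = denominator y′

      shuffle : ∀ p q r s → (p * q) * (r * s) ≈ (p * r) * (q * s)
      shuffle = solve 4 (λ p q r s → (p :* q) :* (r :* s) := (p :* r) :* (q :* s)) refl

  fractionRing : CommutativeRing (c ⊔ ℓ) ℓ
  fractionRing = record
    { Carrier = Fraction
    ; _≈_ = _≈ᶠ_
    ; _+_ = _+ᶠ_
    ; _*_ = _*ᶠ_
    ; -_ = -ᶠ_
    ; 0# = 0ᶠ
    ; 1# = 1ᶠ
    ; isCommutativeRing = record
      { isRing = record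
        { +-isAbelianGroup = record
          { isGroup = record
            { isMonoid = record
              { isSemigroup = record
                { isMagma = record
                  { isEquivalence = record
                    { refl = refl
                    ; sym = sym
                    ; trans = λ {x} {y} {z} → ≈ᶠ-trans x y z
                    }
                  ; ∙-cong = λ {x} {x′} {y} {y′} → +ᶠ-cong x x′ y y′
                  }
                ; assoc = λ x y z → +ᶠ-assoc (numerator x) (denominator x)
                    (numerator y) (denominator y) (numerator z) (denominator z)
                }
              ; identity = (λ x → +ᶠ-identityˡ (numerator x) (denominator x))
                         , (λ x → +ᶠ-identityʳ (numerator x) (denominator x))
              }
            ; inverse = (λ x → inverseˡ (numerator x) (denominator x))
                      , (λ x → inverseʳ (numerator x) (denominator x))
            ; ⁻¹-cong = λ p → trans (sym (-‿distribˡ-* _ _)) (trans (-‿cong p) (-‿distribˡ-* _ _))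
            }
          ; comm = λ x y → +ᶠ-comm (numerator x) (denominator x) (numerator y) (denominator y)
          }
        ; *-cong = λ {x} {x′} {y} {y′} → *ᶠ-cong x x′ y y′
        ; *-assoc = λ x y z → *-cong (*-assoc _ _ _) (sym (*-assoc _ _ _))
        ; *-identity = (λ x → *-cong (*-identityˡ _) (sym (*-identityˡ _)))
                     , (λ x → *-cong (*-identityʳ _) (sym (*-identityʳ _)))
        ; distrib = (λ x y z → distribˡ-ᶠ (numerator x) (denominator x)
                      (numerator y) (denominator y) (numerator z) (denominator z))
                  , (λ x y z → distribʳ-ᶠ (numerator x) (denominator x)
                      (numerator y) (denominator y) (numerator z) (denominator z))
        }
      ; *-comm = λ x y → *-cong (*-comm _ _) (*-comm _ _)
      }
    }
    where
    +ᶠ-assoc : ∀ a b d e f g →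
      ((a * e + d * b) * g + f * (b * e)) * (b * (e * g)) ≈
      (a * (e * g) + (d * g + f * e) * b) * (b * e * g)
    +ᶠ-assoc = solve 6 (λ a b d e f g →
      ((a :* e :+ d :* b) :* g :+ f :* (b :* e)) :* (b :* (e :* g)) :=
      (a :* (e :* g) :+ (d :* g :+ f :* e) :* b) :* (b :* e :* g)) refl

    +ᶠ-comm : ∀ a b d e → (a * e + d * b) * (e * b) ≈ (d * b + a * e) * (b * e)
    +ᶠ-comm = solve 4 (λ a b d e →
      (a :* e :+ d :* b) :* (e :* b) := (d :* b :+ a :* e) :* (b :* e)) refl

    +ᶠ-identityˡ : ∀ a b → (0# * b + a * 1#) * b ≈ a * (1# * b)
    +ᶠ-identityˡ a b = begin
      (0# * b + a * 1#) * b   ≈⟨ *-congʳ (+-cong (zeroˡ b) (*-identityʳ a)) ⟩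
      (0# + a) * b            ≈⟨ *-congʳ (+-identityˡ a) ⟩
      a * b                   ≈⟨ *-congˡ (*-identityˡ b) ⟨
      a * (1# * b)            ∎

    +ᶠ-identityʳ : ∀ a b → (a * 1# + 0# * b) * b ≈ a * (b * 1#)
    +ᶠ-identityʳ a b = begin
      (a * 1# + 0# * b) * b   ≈⟨ *-congʳ (+-comm _ _) ⟩
      (0# * b + a * 1#) * b   ≈⟨ +ᶠ-identityˡ a b ⟩
      a * (1# * b)            ≈⟨ *-congˡ (*-comm _ _) ⟩
      a * (b * 1#)            ∎

    inverseʳ : ∀ a b → (a * b + - a * b) * 1# ≈ 0# * (b * b)
    inverseʳ a b = begin
      (a * b + - a * b) * 1#   ≈⟨ *-identityʳ _ ⟩
      a * b + - a * b          ≈⟨ distribʳ b a (- a) ⟨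
      (a - a) * b              ≈⟨ *-congʳ (-‿inverseʳ a) ⟩
      0# * b                   ≈⟨ zeroˡ b ⟩
      0#                       ≈⟨ zeroˡ _ ⟨
      0# * (b * b)             ∎

    inverseˡ : ∀ a b → (- a * b + a * b) * 1# ≈ 0# * (b * b)
    inverseˡ a b = trans (*-congʳ (+-comm _ _)) (inverseʳ a b)

    distribˡ-ᶠ : ∀ a b d e f g →
      (a * (d * g + f * e)) * ((b * e) * (b * g)) ≈
      ((a * d) * (b * g) + (a * f) * (b * e)) * (b * (e * g))
    distribˡ-ᶠ = solve 6 (λ a b d e f g →
      (a :* (d :* g :+ f :* e)) :* ((b :* e) :* (b :* g)) :=
      ((a :* d) :* (b :* g) :+ (a :* f) :* (b :* e)) :* (b :* (e :* g))) refl

    distribʳ-ᶠ : ∀ a b d e f g →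
      ((d * g + f * e) * a) * ((e * b) * (g * b)) ≈
      ((d * a) * (g * b) + (f * a) * (e * b)) * ((e * g) * b)
    distribʳ-ᶠ = solve 6 (λ a b d e f g →
      ((d :* g :+ f :* e) :* a) :* ((e :* b) :* (g :* b)) :=
      ((d :* a) :* (g :* b) :+ (f :* a) :* (e :* b)) :* ((e :* g) :* b)) refl

ℚ-domain : IntegralDomain 0ℓ 0ℓ
ℚ-domain = record
  { commutativeRing   = ℚ.+-*-commutativeRing
  ; 1≉0               = λ ()
  ; *-cancelˡ-nonZero = cancel
  ; ≈-stable          = λ p q → decidable-stable (p ℚ.≟ q)
  }
  where
  open ≡.≡-Reasoning
  cancel : ∀ p q r → p ≢ 0ℚ → p ℚ.* q ≡ p ℚ.* r → q ≡ r
  cancel p q r p≢0 pq≡pr = begin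
    q                       ≡⟨ unit q ⟨
    1/ p ℚ.* (p ℚ.* q)      ≡⟨ ≡.cong (1/ p ℚ.*_) pq≡pr ⟩
    1/ p ℚ.* (p ℚ.* r)      ≡⟨ unit r ⟩
    r                       ∎
    where
    instance _ = ℚ.≢-nonZero p≢0
    unit : ∀ s → 1/ p ℚ.* (p ℚ.* s) ≡ s
    unit s = ≡.trans (≡.sym (ℚ.*-assoc (1/ p) p s))
      (≡.trans (≡.cong (ℚ._* s) (ℚ.*-inverseˡ p)) (ℚ.*-identityˡ s))

ℚ[y] : IntegralDomain 0ℓ 0ℓ
ℚ[y] = PolynomialDomain.integralDomain ℚ-domain

-- y is the inner and t the outer indeterminate.
ℚ[y,t] : IntegralDomain 0ℓ 0ℓ
ℚ[y,t] = PolynomialDomain.integralDomain ℚ[y]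

ℚ[y]⟦t⟧ : IntegralDomain 0ℓ 0ℓ
ℚ[y]⟦t⟧ = SeriesDomain.integralDomain ℚ[y]

private
  module ℚ[]  = Polynomials ℚ.+-*-commutativeRing
  module ℚ[y] = IntegralDomain ℚ[y]

module RationalFunctions where
  open Fractions ℚ[y,t] public using (Fraction; ι; _÷_[_])
  open CommutativeRing (Fractions.fractionRing ℚ[y,t]) public
  open Algebra.Properties.Semiring.Exp semiring public using (_^_)
  open Enumerators (Fractions.fractionRing ℚ[y,t]) public
  private
    module ℚ[][] = Polynomials ℚ[y].commutativeRing

  y t : Fraction
  y = ι (ℚ[][].const ℚ[].X)
  t = ι ℚ[][].X

  1+y≉0 : ¬ 1# + y ≈ 0#
  1+y≉0 p = contradiction (p 0 0) λ ()

  1+yt≉0 : ¬ 1# + y * t ≈ 0#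
  1+yt≉0 p = contradiction (p 0 0) λ ()

  [y+t][1+yt]≉0 : ¬ (y + t) * (1# + y * t) ≈ 0#
  [y+t][1+yt]≉0 p = contradiction (p 1 0) λ ()

-- Everything lives in the field of fractions of ℚ[y]⟦t⟧, which contains
-- ℚ[y]⟦t⟧ through ι, so that the quotients defining u and v can be written.
module PowerSeriesFractions where
  open Fractions ℚ[y]⟦t⟧ public using (Fraction; ι; _÷_[_])
  open CommutativeRing (Fractions.fractionRing ℚ[y]⟦t⟧) public
  open Algebra.Properties.Semiring.Exp semiring public using (_^_)
  open Enumerators (Fractions.fractionRing ℚ[y]⟦t⟧) public
  private
    module S = PowerSeries ℚ[y].commutativeRing
    module R = CommutativeRing S.seriesRing

  half+half≈1 : ℚ[].const ½ ℚ[y].+ ℚ[].const ½ ℚ[y].≈ ℚ[y].1#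
  half+half≈1 zero    = ≡.refl
  half+half≈1 (suc n) = ≡.refl

  open S.SquareRoot (ℚ[].const ½) half+half≈1 public using (√; √-constant; √-square)

  y t 2# : Fraction
  y  = ι (S.const ℚ[].X)
  t  = ι S.X
  2# = 1# + 1#

  1+t 4y : S.Series
  1+t = R.1# R.+ S.X
  4y  = ((R.1# R.+ R.1#) R.+ (R.1# R.+ R.1#)) R.* S.const ℚ[].X

  -- The radicand (1 + t)² − 4 y t.
  Δ : S.Series
  Δ = 1+t R.* 1+t R.- 4y R.* S.X

  Δ-constant : Δ 0 ℚ[y].≈ ℚ[y].1#
  Δ-constant = S.radicand-constant 4y

  √Δ-square : √ Δ R.* √ Δ R.≈ Δ
  √Δ-square = √-square Δ Δ-constant

  √Δ : Fraction
  √Δ = ι (√ Δ)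

  2[1-y]t≉0 : ¬ 2# * (1# - y) * t ≈ 0#
  2[1-y]t≉0 p = contradiction (p 1 0) λ ()

  2yt≉0 : ¬ 2# * y * t ≈ 0#
  2yt≉0 p = contradiction (p 1 1) λ ()

  u v : Fraction
  u = (1# + t ^ 2 - 2# * y * t - (1# - t) * √Δ) ÷ (2# * (1# - y) * t) [ 2[1-y]t≉0 ]
  v = ((1# + t) ^ 2 - 2# * y * t - (1# + t) * √Δ) ÷ (2# * y * t) [ 2yt≉0 ]

  -- The coefficient of y t² in 1 + u v, cleared of denominators, is 4.
  1+uv≉0 : ¬ 1# + u * v ≈ 0#
  1+uv≉0 p = contradiction
    (denominators-vanish u v p ≡.refl ≡.refl ≡.refl ≡.refl ≡.refl ≡.refl) λ ()
    where
    open Fractions ℚ[y]⟦t⟧ using (numerator; denominator; 1+xy≈0⇒)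

    [_] : ℚ[y].Carrier → ℕ → ℚ
    [_] = ℚ[].coefficient

    *-vanishes : ∀ a b → [ a ] 0 ≡ 0ℚ → [ a ] 1 ≡ 0ℚ → [ a ℚ[y].* b ] 1 ≡ 0ℚ
    *-vanishes a b a₀≡0 a₁≡0 = ≡.cong₂ ℚ._+_
      (≡.trans (≡.cong (ℚ._* [ b ] 1) a₀≡0) (ℚ.*-zeroˡ ([ b ] 1)))
      (≡.cong (ℚ._+ 0ℚ) (≡.trans (≡.cong (ℚ._* [ b ] 0) a₁≡0) (ℚ.*-zeroˡ ([ b ] 0))))

    product-vanishes : ∀ f g → [ f 0 ] 0 ≡ 0ℚ → [ f 0 ] 1 ≡ 0ℚ → [ f 1 ] 0 ≡ 0ℚ →
      [ f 1 ] 1 ≡ 0ℚ → [ g 0 ] 0 ≡ 0ℚ → [ g 0 ] 1 ≡ 0ℚ → [ (f R.* g) 2 ] 1 ≡ 0ℚ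
    product-vanishes f g f₀₀ f₀₁ f₁₀ f₁₁ g₀₀ g₀₁ = ≡.cong₂ ℚ._+_
      (*-vanishes (f 0) (g 2) f₀₀ f₀₁)
      (≡.cong₂ ℚ._+_ (*-vanishes (f 1) (g 1) f₁₀ f₁₁)
        (≡.cong (ℚ._+ 0ℚ) (≡.trans (ℚ[y].*-comm (f 2) (g 0) 1)
          (*-vanishes (g 0) (f 2) g₀₀ g₀₁))))

    sum-vanishes : ∀ f g → f R.+ g R.≈ R.0# → [ g 2 ] 1 ≡ 0ℚ → [ f 2 ] 1 ≡ 0ℚ
    sum-vanishes f g f+g≈0 g₂₁ =
      ≡.trans (≡.sym (ℚ.+-identityʳ _)) (≡.trans (≡.cong ([ f 2 ] 1 ℚ.+_) (≡.sym g₂₁)) (f+g≈0 2 1))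

    denominators-vanish : ∀ x x′ → 1# + x * x′ ≈ 0# →
      [ numerator x 0 ] 0 ≡ 0ℚ → [ numerator x 0 ] 1 ≡ 0ℚ →
      [ numerator x 1 ] 0 ≡ 0ℚ → [ numerator x 1 ] 1 ≡ 0ℚ →
      [ numerator x′ 0 ] 0 ≡ 0ℚ → [ numerator x′ 0 ] 1 ≡ 0ℚ →
      [ (denominator x R.* denominator x′) 2 ] 1 ≡ 0ℚ
    denominators-vanish x x′ q x₀₀ x₀₁ x₁₀ x₁₁ x′₀₀ x′₀₁ =
      sum-vanishes (denominator x R.* denominator x′) (numerator x R.* numerator x′)
        (1+xy≈0⇒ x x′ q)
        (product-vanishes (numerator x) (numerator x′) x₀₀ x₀₁ x₁₀ x₁₁ x′₀₀ x′₀₁)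

{-# OPTIONS --safe #-}
module Submission where

-- A permutation avoiding 231 has the form α n β, where α and β avoid 231, n is
-- the largest letter and every letter of α is below every letter of β.
-- Its descents and peaks are those of α and β, together with a descent at n if
-- β is non-empty and a peak at n if α is non-empty as well.  Hence
-- P₁ = y t and Pₙ₊₁ = (1 + t) Pₙ + Σ Pᵢ Pⱼ, summed over i + j = n with i, j ≥ 1,
-- and y = 1 gives the recurrence of Nₙ.  Multiplying Pₙ(Y, T) by γⁿ⁺¹ replaces
-- the initial value Y T by γ² Y T and the coefficient 1 + T by γ (1 + T), so
-- γⁿ⁺¹ Pₙ(Y, T) = Pₙ(y, t) as soon as γ² Y T = y t and γ (1 + T) = 1 + t.
-- The first identity has y = 1 here, the second one Y = 1 and T = v.

open import Defs
open import Algebra.Bundles using (CommutativeRing)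
import Algebra.Definitions
import Algebra.Properties.Ring
import Algebra.Properties.Semiring.Exp
import Algebra.Properties.Semiring.Sum
import Algebra.Solver.Ring.NaturalCoefficients.Default
open import Data.Bool.Base using (if_then_else_; _∧_)
open import Data.Fin.Base as Fin using (Fin; zero; suc; toℕ; fromℕ<)
import Data.Fin.Properties as Fin
open import Data.List.Base using (List; []; _∷_; _++_; map; concat; applyUpTo; length; lookup; cartesianProductWith)
open import Data.List.Membership.Propositional using (_∈_)
open import Data.List.Membership.Propositional.Properties
open import Data.List.Membership.Propositional.Properties.WithK using (unique∧set⇒bag)
import Data.List.Properties as List
open import Data.List.Relation.Binary.BagAndSetEquality using (∼bag⇒↭)
open import Data.List.Relation.Binary.Disjoint.Propositional using (Disjoint)
import Data.List.Relation.Binary.Permutation.Homogeneous as Permutation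
open import Data.List.Relation.Binary.Permutation.Propositional using (_↭_; ↭⇒↭ₛ)
open import Data.List.Relation.Binary.Permutation.Propositional.Properties using (map⁺)
import Data.List.Relation.Binary.Permutation.Setoid.Properties
open import Data.List.Relation.Unary.All as All using (All; []; _∷_)
import Data.List.Relation.Unary.All.Properties as All
open import Data.List.Relation.Unary.AllPairs as AllPairs using (AllPairs; []; _∷_)
import Data.List.Relation.Unary.AllPairs.Properties as AllPairs
open import Data.List.Relation.Unary.Any using (here; there)
open import Data.List.Relation.Unary.Unique.Propositional using (Unique)
import Data.List.Relation.Unary.Unique.Propositional.Properties as Unique
open import Data.Nat.Base as ℕ using (ℕ; zero; suc; _∸_; _≥_; _<_; _≤_; z≤n; s≤s; z<s; s<s)
import Data.Nat.Properties as ℕ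
open import Data.List.Membership.DecPropositional ℕ._≟_ using (_∈?_)
open import Data.Nat.Solver using () renaming (module +-*-Solver to ℕS)
open import Data.Product.Base using (∃; ∃₂; _×_; _,_; proj₁; proj₂)
open import Data.Vec.Base as Vec using ([]; _∷_)
import Data.Vec.Properties as Vec
open import Function.Base using (_∘_)
open import Function.Bundles using (mk⇔)
open import Level using (Level; _⊔_)
open import Relation.Binary.Core using (Rel)
open import Relation.Binary.Definitions using (tri<; tri≈; tri>)
open import Relation.Binary.PropositionalEquality as ≡ using (_≡_; _≢_)
import Relation.Binary.Reasoning.Setoid
open import Relation.Nullary.Decidable using (does; yes; no; ¬?; _×-dec_; dec-true; dec-false; does-⇔)
open import Relation.Nullary.Negation using (¬_; contradiction)
open import Relation.Unary using (Pred)

-- In `𝔖 n` alphabet and length belong to the type, whereas the two halves of a permutation are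
-- shorter words in smaller alphabets. The decomposition is therefore carried out on lists of
-- natural numbers. It is turned into an equality of sums without an explicit bijection: two
-- duplicate-free lists with the same members are rearrangements of each other. That the letters of
-- the halves form two adjacent intervals is a matter of counting, by the pigeonhole principle. The
-- series u and v are the solution of the two conditions on γ in the second case. Eliminating γ
-- leaves v (1 + t)² = y t (1 + v)², a quadratic equation for v with discriminant (1 + t)² ((1 + t)²
-- - 4 y t). Then γ = (1 + t) / (1 + v), and solving γ = (1 + u) / (1 + u v) for u gives the other
-- series. The conditions on γ are checked, cleared of denominators, in any commutative ring whose
-- non-zero elements cancel, and only then specialised to fields of fractions.

private
  variable
    c ℓ c′ ℓ′ : Level

-- Decomposition of 231-avoiding permutations at the largest letter

module Avoiders where
  open import Data.Nat.Base using (_+_)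
  open ≡

  private
    variable
      a p r : Level
      A B C : Set a
      k m n : ℕ
      w : List ℕ

  module _ {R : Rel A r} where

    AllPairs-++⁻ : ∀ xs {ys} → AllPairs R (xs ++ ys) →
      AllPairs R xs × AllPairs R ys × All (λ x → All (R x) ys) xs
    AllPairs-++⁻ []       Rys         = [] , Rys , []
    AllPairs-++⁻ (x ∷ xs) (Rx ∷ Rxys) =
      let Rxs , Rys , Rxsys = AllPairs-++⁻ xs Rxys
      in  All.++⁻ˡ xs Rx ∷ Rxs , Rys , All.++⁻ʳ xs Rx ∷ Rxsys

  All⇒AllPairs : ∀ {P : Pred A p} {R : Rel A r} → (∀ {x y} → P x → P y → R x y) →
    ∀ {xs} → All P xs → AllPairs R xs
  All⇒AllPairs f []         = []
  All⇒AllPairs f (px ∷ pxs) = All.map (f px) pxs ∷ All⇒AllPairs f pxs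

  Unique⇒lookup-injective : ∀ {xs : List A} → Unique xs →
    ∀ {i j} → lookup xs i ≡ lookup xs j → i ≡ j
  Unique⇒lookup-injective (_  ∷ _)   {zero}  {zero}  _  = refl
  Unique⇒lookup-injective (x∉ ∷ _)   {zero}  {suc j} eq = contradiction eq (All.lookup x∉ (∈-lookup j))
  Unique⇒lookup-injective (x∉ ∷ _)   {suc i} {zero}  eq = contradiction (sym eq) (All.lookup x∉ (∈-lookup i))
  Unique⇒lookup-injective (_  ∷ xs!) {suc i} {suc j} eq = cong suc (Unique⇒lookup-injective xs! eq)

  -- Pigeonhole principle: reading off the letters injects the positions into `Fin m`.
  Unique∧bounded⇒length≤ : ∀ {xs} → Unique xs → All (_< m) xs → length xs ≤ m
  Unique∧bounded⇒length≤ {xs = xs} xs! xs<m = Fin.injective⇒≤ λ {i} {j} eq →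
    Unique⇒lookup-injective xs! (Fin.fromℕ<-injective _ _ (bound i) (bound j) eq)
    where
    bound : ∀ i → lookup xs i < _
    bound i = All.lookup xs<m (∈-lookup i)

  -- Injectivity is asked only for first arguments taken from `xs`, because `join n` is not
  -- injective on arbitrary lists.
  cartesianProductWith-Unique : ∀ (f : A → B → C) {xs ys} →
    (∀ {a a′ b b′} → a ∈ xs → a′ ∈ xs → f a b ≡ f a′ b′ → a ≡ a′ × b ≡ b′) →
    Unique xs → Unique ys → Unique (cartesianProductWith f xs ys)
  cartesianProductWith-Unique f {[]} inj [] ys! = []
  cartesianProductWith-Unique f {x ∷ xs} {ys} inj (x∉ ∷ xs!) ys! = Unique.++⁺
    (Unique.map⁺ (λ eq → proj₂ (inj (here refl) (here refl) eq)) ys!)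
    (cartesianProductWith-Unique f (λ a∈ a′∈ → inj (there a∈) (there a′∈)) xs! ys!)
    disjoint
    where
    disjoint : Disjoint (map (f x) ys) (cartesianProductWith f xs ys)
    disjoint (v∈₁ , v∈₂) with ∈-map⁻ (f x) v∈₁ | ∈-cartesianProductWith⁻ f xs ys v∈₂
    ... | b , _ , eq | a , b′ , a∈ , _ , eq′ =
      All.lookup x∉ a∈ (proj₁ (inj (here refl) (there a∈) (trans (sym eq) eq′)))

  -- Neither α nor α′ contains `n`, so both cuts are at the first occurrence of `n`.
  split-unique : ∀ {n α α′} {β β′ : List ℕ} → All (_< n) α → All (_< n) α′ →
    α ++ n ∷ β ≡ α′ ++ n ∷ β′ → α ≡ α′ × β ≡ β′
  split-unique []        []        refl = refl , refl
  split-unique []        (n<n ∷ _) refl = contradiction n<n (ℕ.<-irrefl refl)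
  split-unique (n<n ∷ _) []        refl = contradiction n<n (ℕ.<-irrefl refl)
  split-unique (_ ∷ α<)  (_ ∷ α′<) eq   with List.∷-injective eq
  ... | refl , eq′ with split-unique α< α′< eq′
  ... | refl , refl = refl , refl

  unshift : ∀ {xs} → All (k ≤_) xs → ∃ λ ys → xs ≡ map (k +_) ys
  unshift []             = [] , refl
  unshift (k≤x ∷ k≤xs) with unshift k≤xs
  ... | ys , refl = _ ∷ ys , cong (_∷ _) (sym (ℕ.m+[n∸m]≡n k≤x))

  -- Patterns are sorted by their first letter: the pairs condition excludes those led by the head
  -- `a`. This form can be cut and glued by structural induction, without positions.
  data Avoids231 : List ℕ → Set where
    []  : Avoids231 []
    _∷_ : ∀ {a w} → AllPairs (λ b c → ¬ (c < a × a < b)) w → Avoids231 w → Avoids231 (a ∷ w)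

  Avoids231-++⁻ : ∀ α {β} → Avoids231 (α ++ β) → Avoids231 α × Avoids231 β
  Avoids231-++⁻ []      av         = [] , av
  Avoids231-++⁻ (a ∷ α) (av₁ ∷ av) =
    let αv , βv = Avoids231-++⁻ α av
    in  proj₁ (AllPairs-++⁻ α av₁) ∷ αv , βv

  module _ (k : ℕ) where

    Avoids231-shift⁺ : Avoids231 w → Avoids231 (map (k +_) w)
    Avoids231-shift⁺ []         = []
    Avoids231-shift⁺ (av₁ ∷ av) =
      AllPairs.map⁺ (AllPairs.map (λ ¬p (c<a , a<b) → ¬p (ℕ.+-cancelˡ-< k _ _ c<a , ℕ.+-cancelˡ-< k _ _ a<b)) av₁)
      ∷ Avoids231-shift⁺ av

    Avoids231-shift⁻ : ∀ w → Avoids231 (map (k +_) w) → Avoids231 w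
    Avoids231-shift⁻ []      _          = []
    Avoids231-shift⁻ (a ∷ w) (av₁ ∷ av) =
      AllPairs.map (λ ¬p (c<a , a<b) → ¬p (ℕ.+-monoʳ-< k c<a , ℕ.+-monoʳ-< k a<b)) (AllPairs.map⁻ av₁)
      ∷ Avoids231-shift⁻ w av

    Unique-shift⁺ : Unique w → Unique (map (k +_) w)
    Unique-shift⁺ = Unique.map⁺ (ℕ.+-cancelˡ-≡ k _ _)

    bounded-shift⁻ : ∀ w → All (_< k + m) (map (k +_) w) → All (_< m) w
    bounded-shift⁻ w bd = All.map (ℕ.+-cancelˡ-< k _ _) (All.map⁻ bd)

  -- Forgetting alphabet and length lets words of all sizes be concatenated and shifted in one type.
  letters : Word n k → List ℕ
  letters π = Vec.toList (Vec.map toℕ π)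

  module _ {P : Pred ℕ p} where

    All-letters⁺ : (π : Word n k) → (∀ i → P (toℕ (Vec.lookup π i))) → All P (letters π)
    All-letters⁺ []      _ = []
    All-letters⁺ (_ ∷ π) h = h zero ∷ All-letters⁺ π (h ∘ suc)

    All-letters⁻ : (π : Word n k) → All P (letters π) → ∀ i → P (toℕ (Vec.lookup π i))
    All-letters⁻ (_ ∷ _) (p ∷ _)  zero    = p
    All-letters⁻ (_ ∷ π) (_ ∷ ps) (suc i) = All-letters⁻ π ps i

  module _ {R : Rel ℕ r} where

    AllPairs-letters⁺ : (π : Word n k) →
      (∀ i j → i Fin.< j → R (toℕ (Vec.lookup π i)) (toℕ (Vec.lookup π j))) → AllPairs R (letters π)
    AllPairs-letters⁺ []      _ = []
    AllPairs-letters⁺ (_ ∷ π) h = All-letters⁺ π (λ j → h zero (suc j) z<s)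
      ∷ AllPairs-letters⁺ π (λ i j i<j → h (suc i) (suc j) (s<s i<j))

    AllPairs-letters⁻ : (π : Word n k) → AllPairs R (letters π) →
      ∀ i j → i Fin.< j → R (toℕ (Vec.lookup π i)) (toℕ (Vec.lookup π j))
    AllPairs-letters⁻ (_ ∷ π) (Rx ∷ _) zero    (suc j) _         = All-letters⁻ π Rx j
    AllPairs-letters⁻ (_ ∷ π) (_ ∷ Rπ) (suc i) (suc j) (s<s i<j) = AllPairs-letters⁻ π Rπ i j i<j

  Unique-letters⁺ : (π : Word n n) → IsPermutation π → Unique (letters π)
  Unique-letters⁺ π perm = AllPairs-letters⁺ π λ i j i<j eq →
    Fin.<⇒≢ i<j (perm i j (Fin.toℕ-injective eq))

  Unique-letters⁻ : (π : Word n n) → Unique (letters π) → IsPermutation π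
  Unique-letters⁻ π π! i j eq with Fin.<-cmp i j
  ... | tri< i<j _ _ = contradiction (cong toℕ eq) (AllPairs-letters⁻ π π! i j i<j)
  ... | tri≈ _ i≡j _ = i≡j
  ... | tri> _ _ j<i = contradiction (cong toℕ (sym eq)) (AllPairs-letters⁻ π π! j i j<i)

  Avoids231-letters⁺ : (π : Word n k) → ¬ Contains231 π → Avoids231 (letters π)
  Avoids231-letters⁺ []      _ = []
  Avoids231-letters⁺ (_ ∷ π) h =
    AllPairs-letters⁺ π (λ j l j<l (c<a , a<b) → h (zero , suc j , suc l , z<s , s<s j<l , c<a , a<b))
    ∷ Avoids231-letters⁺ π λ (i , j , l , i<j , j<l , p) →
        h (suc i , suc j , suc l , s<s i<j , s<s j<l , p)

  Avoids231-letters⁻ : (π : Word n k) → Avoids231 (letters π) → ¬ Contains231 π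
  Avoids231-letters⁻ (_ ∷ π) (av₁ ∷ _) (zero  , suc j , suc l , _       , s<s j<l , p) =
    AllPairs-letters⁻ π av₁ j l j<l p
  Avoids231-letters⁻ (_ ∷ π) (_ ∷ av)  (suc i , suc j , suc l , s<s i<j , s<s j<l , p) =
    Avoids231-letters⁻ π av (i , j , l , i<j , j<l , p)

  letters-injective : {π ρ : Word n k} → letters π ≡ letters ρ → π ≡ ρ
  letters-injective {π = []}    {[]}    _  = refl
  letters-injective {π = _ ∷ _} {_ ∷ _} eq with List.∷-injective eq
  ... | a≡b , eq′ = cong₂ _∷_ (Fin.toℕ-injective a≡b) (letters-injective eq′)

  length-letters : (π : Word n k) → length (letters π) ≡ k
  length-letters π = Vec.length-toList (Vec.map toℕ π)

  fromLetters : ∀ w → All (_< n) w → ∃ λ (π : Word n (length w)) → letters π ≡ w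
  fromLetters []      []         = [] , refl
  fromLetters (_ ∷ w) (a<n ∷ w<) =
    let π , eq = fromLetters w w< in fromℕ< a<n ∷ π , cong₂ _∷_ (Fin.toℕ-fromℕ< a<n) eq

  ∈-words : (π : Word n k) → π ∈ words n k
  ∈-words []      = here refl
  ∈-words (a ∷ π) = ∈-cartesianProductWith⁺ _∷_ (∈-allFin a) (∈-words π)

  words-Unique : ∀ n k → Unique (words n k)
  words-Unique n zero    = [] ∷ []
  words-Unique n (suc k) =
    Unique.cartesianProductWith⁺ _∷_ Vec.∷-injective (Unique.allFin⁺ n) (words-Unique n k)

  avoiders : ℕ → List (List ℕ)
  avoiders n = map letters (Av231 n)

  -- Length, bound and distinctness together say that `w` is a permutation of 0, ..., n - 1.
  record IsAvoider (n : ℕ) (w : List ℕ) : Set where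
    constructor isAvoider
    field
      length≡n : length w ≡ n
      bounded  : All (_< n) w
      unique   : Unique w
      avoids   : Avoids231 w

  avoiders-Unique : ∀ n → Unique (avoiders n)
  avoiders-Unique n = Unique.map⁺ letters-injective
    (Unique.filter⁺ (λ π → ¬? (contains231? π)) (Unique.filter⁺ isPermutation? (words-Unique n n)))

  ∈-avoiders⁻ : w ∈ avoiders n → IsAvoider n w
  ∈-avoiders⁻ {n = n} w∈ with ∈-map⁻ letters w∈
  ... | π , π∈ , refl with ∈-filter⁻ (λ π → ¬? (contains231? π)) {xs = 𝔖 n} π∈
  ... | π∈𝔖 , ¬231 = isAvoider
    (length-letters π)
    (All-letters⁺ π λ i → Fin.toℕ<n (Vec.lookup π i))
    (Unique-letters⁺ π (proj₂ (∈-filter⁻ isPermutation? {xs = words n n} π∈𝔖)))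
    (Avoids231-letters⁺ π ¬231)

  ∈-avoiders⁺ : IsAvoider n w → w ∈ avoiders n
  ∈-avoiders⁺ (isAvoider refl w< w! av) with fromLetters _ w<
  ... | π , eq = subst (_∈ _) eq (∈-map⁺ letters
    (∈-filter⁺ (λ π → ¬? (contains231? π))
      (∈-filter⁺ isPermutation? (∈-words π) (Unique-letters⁻ π (subst Unique (sym eq) w!)))
      (Avoids231-letters⁻ π (subst Avoids231 (sym eq) av))))

  -- The letters of an avoider α of length k are 0, ..., k - 1, so the shift by `length α` puts
  -- those of β right above them. The parameter `n` stands for the sum of both lengths.
  join : ℕ → List ℕ → List ℕ → List ℕ
  join n α β = α ++ n ∷ map (length α +_) β

  -- Gluing two avoiders

  module _ {α β k l} (α-av : IsAvoider k α) (β-av : IsAvoider l β) where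
    private
      module α = IsAvoider α-av
      module β = IsAvoider β-av
      β′ = map (k +_) β

      α<k+l : All (_< k + l) α
      α<k+l = All.map (λ a<k → ℕ.<-≤-trans a<k (ℕ.m≤m+n k l)) α.bounded

      β′<k+l : All (_< k + l) β′
      β′<k+l = All.map⁺ (All.map (ℕ.+-monoʳ-< k) β.bounded)

      k≤β′ : All (k ≤_) β′
      k≤β′ = All.map⁺ (All.universal (ℕ.m≤m+n k) β)

      length-join : length (α ++ k + l ∷ β′) ≡ suc (k + l)
      length-join = begin
        length (α ++ k + l ∷ β′)       ≡⟨ List.length-++ α ⟩
        length α + suc (length β′)     ≡⟨ cong₂ (λ x y → x + suc y) α.length≡n (trans (List.length-map _ β) β.length≡n) ⟩
        k + suc l                      ≡⟨ ℕ.+-suc k l ⟩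
        suc (k + l)                    ∎
        where open ≡-Reasoning

      above : ∀ {a b c} → a < k → k ≤ c → ¬ (c < a × a < b)
      above a<k k≤c (c<a , _) = ℕ.<⇒≱ (ℕ.<-trans c<a a<k) k≤c

      k≤n∷β′ : All (k ≤_) (k + l ∷ β′)
      k≤n∷β′ = ℕ.m≤m+n k l ∷ k≤β′

      -- A pattern led by a letter of α cannot end in `k + l ∷ β′`, whose letters are all larger,
      -- and the largest letter leads no pattern. The α bound here ranges over suffixes of the outer
      -- one, to which the induction passes.
      join-avoids : ∀ {α} → All (_< k) α → Avoids231 α → Avoids231 (α ++ k + l ∷ β′)
      join-avoids []         []         =
        All⇒AllPairs (λ b<n _ (_ , n<b) → ℕ.<-asym b<n n<b) β′<k+l ∷ Avoids231-shift⁺ k β.avoids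
      join-avoids (a<k ∷ α<) (av₁ ∷ av) =
        AllPairs.++⁺ av₁
          (All⇒AllPairs (λ _ → above a<k) k≤n∷β′)
          (All.universal (λ _ → All.map (above a<k) k≤n∷β′) _)
        ∷ join-avoids α< av

    join-isAvoider : IsAvoider (suc (k + l)) (join (k + l) α β)
    join-isAvoider rewrite α.length≡n = isAvoider
      length-join
      (All.++⁺ (All.map ℕ.m<n⇒m<1+n α<k+l) (ℕ.n<1+n _ ∷ All.map ℕ.m<n⇒m<1+n β′<k+l))
      (AllPairs.++⁺ α.unique
        (All.map (≢-sym ∘ ℕ.<⇒≢) β′<k+l ∷ Unique-shift⁺ k β.unique)
        (All.map (λ a<k → All.map (ℕ.<⇒≢ ∘ ℕ.<-≤-trans a<k) k≤n∷β′) α.bounded))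
      (join-avoids α.bounded α.avoids)

  -- Without the letter `n`, the word would consist of n + 1 distinct letters below `n`.
  maximum∈ : IsAvoider (suc n) w → n ∈ w
  maximum∈ {n} {w} (isAvoider len w< w! _) with n ∈? w
  ... | yes n∈w = n∈w
  ... | no  n∉w = contradiction (subst (_≤ n) len (Unique∧bounded⇒length≤ w! bounded)) (ℕ.<-irrefl refl)
    where
    bounded : All (_< n) w
    bounded = All.tabulate λ x∈ → ℕ.≤∧≢⇒< (ℕ.s≤s⁻¹ (All.lookup w< x∈)) λ { refl → n∉w x∈ }

  All-strengthen : ∀ {xs} → All (_< suc n) xs → All (n ≢_) xs → All (_< n) xs
  All-strengthen xs< n≢xs = All.zipWith (λ (x<1+n , n≢x) → ℕ.≤∧≢⇒< (ℕ.s≤s⁻¹ x<1+n) (≢-sym n≢x)) (xs< , n≢xs)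

  -- Cutting an avoider at its largest letter

  module _ {α β′ n} (w-av : IsAvoider (suc n) (α ++ n ∷ β′)) where
    private
      module w = IsAvoider w-av
      ∣α∣ = length α
      ∣β∣ = length β′

      k+l≡n : ∣α∣ + ∣β∣ ≡ n
      k+l≡n = ℕ.suc-injective (trans (sym (ℕ.+-suc ∣α∣ ∣β∣)) (trans (sym (List.length-++ α)) w.length≡n))

      uniques : Unique α × Unique (n ∷ β′) × All (λ a → All (a ≢_) (n ∷ β′)) α
      uniques = AllPairs-++⁻ α w.unique

      α! : Unique α
      α! = proj₁ uniques

      β′! : Unique β′
      β′! = AllPairs.tail (proj₁ (proj₂ uniques))

      α<n : All (_< n) α
      α<n = All-strengthen (All.++⁻ˡ α w.bounded) (All.map (≢-sym ∘ All.head) (proj₂ (proj₂ uniques)))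

      β′<n : All (_< n) β′
      β′<n = All-strengthen (All.tail (All.++⁻ʳ α w.bounded)) (AllPairs.head (proj₁ (proj₂ uniques)))

      -- If c in β′ were below a in α, the letters a, n, c would form the pattern 231.
      α≤β′ : ∀ {α} → All (_< n) α → Avoids231 (α ++ n ∷ β′) → All (λ a → All (a ≤_) β′) α
      α≤β′ []         _          = []
      α≤β′ {_ ∷ α} (a<n ∷ α<) (av₁ ∷ av) =
        All.map (λ ¬p → ℕ.≮⇒≥ λ c<a → ¬p (c<a , a<n)) (AllPairs.head (proj₁ (proj₂ (AllPairs-++⁻ α av₁))))
        ∷ α≤β′ α< av

      α<β′ : All (λ a → All (a <_) β′) α
      α<β′ = All.zipWith (λ (a≤ , a≢) → All.zipWith (λ (a≤b , a≢b) → ℕ.≤∧≢⇒< a≤b a≢b) (a≤ , All.tail a≢))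
        (α≤β′ α<n w.avoids , proj₂ (proj₂ uniques))

      -- A letter of β′ bounds the distinct letters of α strictly from above, so it is at least
      -- their number.
      k≤β′ : All (∣α∣ ≤_) β′
      k≤β′ = All.tabulate λ b∈ → Unique∧bounded⇒length≤ α! (All.map (λ a< → All.lookup a< b∈) α<β′)

      -- A letter a of α with ∣α∣ ≤ a would give, together with β′, ∣β∣ + 1 distinct letters in the
      -- interval from ∣α∣ to n - 1, which has ∣β∣ elements.
      α<k : All (_< ∣α∣) α
      α<k = All.tabulate λ {a} a∈ → ℕ.≰⇒> λ k≤a →
        let a∷β′! : Unique (a ∷ β′)
            a∷β′! = All.map ℕ.<⇒≢ (All.lookup α<β′ a∈) ∷ β′!
            ys , eq = unshift (k≤a ∷ k≤β′)
            ys! = Unique.map⁻ (subst Unique eq a∷β′!)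
            ys< = bounded-shift⁻ ∣α∣ ys (subst₂ (λ n → All (_< n)) (sym k+l≡n) eq (All.lookup α<n a∈ ∷ β′<n))
            1+l≡ = trans (cong length eq) (List.length-map (∣α∣ +_) ys)
        in  ℕ.<-irrefl refl (subst (_≤ ∣β∣) (sym 1+l≡) (Unique∧bounded⇒length≤ ys! ys<))

    unjoin : ∃₂ λ k l → ∃₂ λ α′ β → k + l ≡ n × IsAvoider k α′ × IsAvoider l β × α ++ n ∷ β′ ≡ join n α′ β
    unjoin with unshift k≤β′
    ... | β , eq = ∣α∣ , ∣β∣ , α , β , k+l≡n
      , isAvoider refl α<k α! (proj₁ (Avoids231-++⁻ α w.avoids))
      , isAvoider (sym (trans (cong length eq) (List.length-map (∣α∣ +_) β)))
          (bounded-shift⁻ ∣α∣ β (subst₂ (λ n → All (_< n)) (sym k+l≡n) eq β′<n))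
          (Unique.map⁻ (subst Unique eq β′!))
          (Avoids231-shift⁻ ∣α∣ β (subst Avoids231 eq (tail (proj₂ (Avoids231-++⁻ α w.avoids)))))
      , cong (λ β → α ++ n ∷ β) eq
      where
      tail : ∀ {a w} → Avoids231 (a ∷ w) → Avoids231 w
      tail (_ ∷ av) = av

  decompose : IsAvoider (suc n) w →
    ∃₂ λ k l → ∃₂ λ α β → k + l ≡ n × IsAvoider k α × IsAvoider l β × w ≡ join n α β
  decompose w-av with ∈-∃++ (maximum∈ w-av)
  ... | _ , _ , refl = unjoin w-av

  -- The avoiders of size n + 1, sorted by the position of the largest letter

  joins : ℕ → ℕ → List (List ℕ)
  joins n k = cartesianProductWith (join n) (avoiders k) (avoiders (n ∸ k))

  ∈-joins⁻ : k ≤ n → w ∈ joins n k →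
    ∃₂ λ α β → IsAvoider k α × IsAvoider (n ∸ k) β × All (_< n) α × w ≡ join n α β
  ∈-joins⁻ {k} {n} k≤n w∈ with ∈-cartesianProductWith⁻ (join n) (avoiders k) (avoiders (n ∸ k)) w∈
  ... | α , β , α∈ , β∈ , eq = α , β , ∈-avoiders⁻ α∈ , ∈-avoiders⁻ β∈ ,
    All.map (λ a<k → ℕ.<-≤-trans a<k k≤n) (IsAvoider.bounded (∈-avoiders⁻ α∈)) , eq

  ∈-joins⁺ : ∀ {k l n α β} → k + l ≡ n → IsAvoider k α → IsAvoider l β →
    join n α β ∈ concat (applyUpTo (joins n) (suc n))
  ∈-joins⁺ {k} {l} {β = β} refl α-av β-av = ∈-concat⁺′
    (∈-cartesianProductWith⁺ (join (k + l)) (∈-avoiders⁺ α-av)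
      (∈-avoiders⁺ (subst (λ l → IsAvoider l β) (sym (ℕ.m+n∸m≡n k l)) β-av)))
    (∈-applyUpTo⁺ (joins (k + l)) (s≤s (ℕ.m≤m+n k l)))

  joins-Unique : k ≤ n → Unique (joins n k)
  joins-Unique {k} {n} k≤n = cartesianProductWith-Unique (join n) injective
    (avoiders-Unique k) (avoiders-Unique (n ∸ k))
    where
    bounded : ∀ {α} → α ∈ avoiders k → All (_< n) α
    bounded α∈ = All.map (λ a<k → ℕ.<-≤-trans a<k k≤n) (IsAvoider.bounded (∈-avoiders⁻ α∈))

    injective : ∀ {α α′ β β′} → α ∈ avoiders k → α′ ∈ avoiders k →
      join n α β ≡ join n α′ β′ → α ≡ α′ × β ≡ β′
    injective {α} α∈ α′∈ eq with split-unique (bounded α∈) (bounded α′∈) eq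
    ... | refl , eq′ = refl , List.map-injective (ℕ.+-cancelˡ-≡ (length α) _ _) eq′

  -- The index of the block is recovered from a word as the number of letters before `n`.
  joins-Disjoint : ∀ {k k′} → k < k′ → k′ ≤ n → Disjoint (joins n k) (joins n k′)
  joins-Disjoint k<k′ k′≤n (w∈ , w∈′)
    with ∈-joins⁻ (ℕ.≤-trans (ℕ.<⇒≤ k<k′) k′≤n) w∈ | ∈-joins⁻ k′≤n w∈′
  ... | α , β , α-av , _ , α<n , refl | α′ , β′ , α′-av , _ , α′<n , eq =
    ℕ.<⇒≢ k<k′ (trans (sym (IsAvoider.length≡n α-av))
      (trans (cong length (proj₁ (split-unique α<n α′<n eq))) (IsAvoider.length≡n α′-av)))

  -- Both lists are free of duplicates, so having the same members makes them rearrangements of each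
  -- other; `decompose` and `join-isAvoider` provide the two inclusions.
  avoiders-suc : ∀ n → avoiders (suc n) ↭ concat (applyUpTo (joins n) (suc n))
  avoiders-suc n = ∼bag⇒↭ (unique∧set⇒bag (avoiders-Unique (suc n)) joins! (mk⇔ to from))
    where
    joins! : Unique (concat (applyUpTo (joins n) (suc n)))
    joins! = Unique.concat⁺
      (All.applyUpTo⁺₁ (joins n) (suc n) (joins-Unique ∘ ℕ.s≤s⁻¹))
      (AllPairs.applyUpTo⁺₁ (joins n) (suc n) λ i<j j≤n → joins-Disjoint i<j (ℕ.s≤s⁻¹ j≤n))

    to : ∀ {w} → w ∈ avoiders (suc n) → w ∈ concat (applyUpTo (joins n) (suc n))
    to w∈ =
      let _ , _ , _ , _ , k+l≡n , α-av , β-av , eq = decompose (∈-avoiders⁻ w∈)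
      in  subst (_∈ concat (applyUpTo (joins n) (suc n))) (sym eq) (∈-joins⁺ k+l≡n α-av β-av)

    from : ∀ {w} → w ∈ concat (applyUpTo (joins n) (suc n)) → w ∈ avoiders (suc n)
    from w∈ =
      let _ , w∈js , js∈ = ∈-concat⁻′ (applyUpTo (joins n) (suc n)) w∈
          k , k<1+n , js≡ = ∈-applyUpTo⁻ (joins n) js∈
          k≤n = ℕ.s≤s⁻¹ k<1+n
          α , β , α-av , β-av , _ , w≡ = ∈-joins⁻ k≤n (subst (_ ∈_) js≡ w∈js)
      in  ∈-avoiders⁺ (subst₂ (λ n → IsAvoider (suc n)) (ℕ.m+[n∸m]≡n k≤n)
            (trans (cong (λ n → join n α β) (ℕ.m+[n∸m]≡n k≤n)) (sym w≡))
            (join-isAvoider α-av β-av))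

open Avoiders

-- Descents and peaks around the largest letter

module WordStatistics where
  private
    variable
      k n : ℕ

  descents : List ℕ → ℕ
  descents []          = 0
  descents (_ ∷ [])    = 0
  descents (a ∷ b ∷ w) = (if does (b ℕ.<? a) then 1 else 0) ℕ.+ descents (b ∷ w)

  peaks : List ℕ → ℕ
  peaks []              = 0
  peaks (_ ∷ [])        = 0
  peaks (_ ∷ _ ∷ [])    = 0
  peaks (a ∷ b ∷ d ∷ w) =
    (if does ((a ℕ.<? b) ×-dec (d ℕ.<? b)) then 1 else 0) ℕ.+ peaks (b ∷ d ∷ w)

  -- Comparison in `Fin` unfolds to comparison of the underlying numbers, so the first summands
  -- agree by computation.
  descents-letters : (π : Word n k) → descents (letters π) ≡ des π
  descents-letters []          = ≡.refl
  descents-letters (_ ∷ [])    = ≡.refl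
  descents-letters (a ∷ b ∷ π) = ≡.cong (_ ℕ.+_) (descents-letters (b ∷ π))

  peaks-letters : (π : Word n k) → peaks (letters π) ≡ pk π
  peaks-letters []              = ≡.refl
  peaks-letters (_ ∷ [])        = ≡.refl
  peaks-letters (_ ∷ _ ∷ [])    = ≡.refl
  peaks-letters (a ∷ b ∷ d ∷ π) = ≡.cong (_ ℕ.+_) (peaks-letters (b ∷ d ∷ π))

  module _ (k : ℕ) where
    <?-shift : ∀ a b → does (k ℕ.+ a ℕ.<? k ℕ.+ b) ≡ does (a ℕ.<? b)
    <?-shift a b = does-⇔ (mk⇔ (ℕ.+-cancelˡ-< k a b) (ℕ.+-monoʳ-< k)) (_ ℕ.<? _) (_ ℕ.<? _)

    descents-shift : ∀ w → descents (map (k ℕ.+_) w) ≡ descents w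
    descents-shift []          = ≡.refl
    descents-shift (_ ∷ [])    = ≡.refl
    descents-shift (a ∷ b ∷ w) = ≡.cong₂ (λ d n → (if d then 1 else 0) ℕ.+ n)
      (<?-shift b a) (descents-shift (b ∷ w))

    peaks-shift : ∀ w → peaks (map (k ℕ.+_) w) ≡ peaks w
    peaks-shift []              = ≡.refl
    peaks-shift (_ ∷ [])        = ≡.refl
    peaks-shift (_ ∷ _ ∷ [])    = ≡.refl
    peaks-shift (a ∷ b ∷ d ∷ w) = ≡.cong₂ (λ p n → (if p then 1 else 0) ℕ.+ n)
      (≡.cong₂ _∧_ (<?-shift a b) (<?-shift d b)) (peaks-shift (b ∷ d ∷ w))

  -- The step from the last letter of α up to `n` is an ascent.
  descents-++-max : ∀ {n α} β → All (_< n) α →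
    descents (α ++ n ∷ β) ≡ descents α ℕ.+ descents (n ∷ β)
  descents-++-max β [] = ≡.refl
  descents-++-max {n} {a ∷ []} β (a<n ∷ [])
    rewrite dec-false (n ℕ.<? a) (ℕ.<-asym a<n) = ≡.refl
  descents-++-max {α = a ∷ b ∷ α} β (_ ∷ b<n ∷ α<n) = ≡.trans
    (≡.cong (_ ℕ.+_) (descents-++-max β (b<n ∷ α<n)))
    (≡.sym (ℕ.+-assoc (if does (b ℕ.<? a) then 1 else 0) _ _))

  descents-max∷ : ∀ {n b} β → b < n → descents (n ∷ b ∷ β) ≡ suc (descents (b ∷ β))
  descents-max∷ {n} {b} β b<n rewrite dec-true (b ℕ.<? n) b<n = ≡.refl

  -- A leading letter is no peak, and the letter after it stays none because its new left neighbour
  -- `n` is larger.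
  peaks-max∷ : ∀ {n β} → All (_< n) β → peaks (n ∷ β) ≡ peaks β
  peaks-max∷ []           = ≡.refl
  peaks-max∷ (_ ∷ [])     = ≡.refl
  peaks-max∷ {n} {b ∷ _ ∷ _} (b<n ∷ _ ∷ _) rewrite dec-false (n ℕ.<? b) (ℕ.<-asym b<n) = ≡.refl

  peaks-++-max : ∀ {n a α} → All (_< n) (a ∷ α) → peaks (a ∷ α ++ n ∷ []) ≡ peaks (a ∷ α)
  peaks-++-max (_ ∷ []) = ≡.refl
  peaks-++-max {n} {a} {b ∷ []} (a<n ∷ b<n ∷ [])
    rewrite dec-false ((a ℕ.<? b) ×-dec (n ℕ.<? b)) (λ (_ , n<b) → ℕ.<-asym b<n n<b) = ≡.refl
  peaks-++-max {α = _ ∷ _ ∷ _} (_ ∷ b<n ∷ d<n ∷ α<n) =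
    ≡.cong (_ ℕ.+_) (peaks-++-max (b<n ∷ d<n ∷ α<n))

  -- The additional peak is `n`. Its two neighbours were end letters of their words, hence no peaks,
  -- and remain none next to a larger letter.
  peaks-++-max-++ : ∀ {n a α b β} → All (_< n) (a ∷ α) → All (_< n) (b ∷ β) →
    peaks (a ∷ α ++ n ∷ b ∷ β) ≡ suc (peaks (a ∷ α) ℕ.+ peaks (b ∷ β))
  peaks-++-max-++ {n} {a} {[]} {b} (a<n ∷ []) β<n@(b<n ∷ _)
    rewrite dec-true ((a ℕ.<? n) ×-dec (b ℕ.<? n)) (a<n , b<n) = ≡.cong suc (peaks-max∷ β<n)
  peaks-++-max-++ {n} {a} {b ∷ []} (_ ∷ b<n ∷ []) β<n
    rewrite dec-false ((a ℕ.<? b) ×-dec (n ℕ.<? b)) (λ (_ , n<b) → ℕ.<-asym b<n n<b) =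
    peaks-++-max-++ (b<n ∷ []) β<n
  peaks-++-max-++ {a = a} {b ∷ d ∷ _} (_ ∷ b<n ∷ d<n ∷ α<n) β<n = ≡.trans
    (≡.cong (p ℕ.+_) (peaks-++-max-++ (b<n ∷ d<n ∷ α<n) β<n))
    (≡.trans (ℕ.+-suc p _) (≡.cong suc (≡.sym (ℕ.+-assoc p _ _))))
    where p = if does ((a ℕ.<? b) ×-dec (d ℕ.<? b)) then 1 else 0

open WordStatistics

-- Quadratic recurrences: uniqueness and rescaling

module ConvolutionRecurrence (R : CommutativeRing c ℓ) where
  open CommutativeRing R
  open Algebra.Properties.Semiring.Exp semiring using (_^_; ^-homo-*; ^-congʳ)
  open Algebra.Properties.Semiring.Sum semiring using (sum; sum-cong-≋; *-distribˡ-sum)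
  open Relation.Binary.Reasoning.Setoid setoid
  open Algebra.Solver.Ring.NaturalCoefficients.Default commutativeSemiring
    using (solve; _:=_; _:+_; _:*_; con)

  -- The value `p n` belongs to permutations of size n + 1; the sizes i + 1 and n - i of the two
  -- factors add up to n + 1.
  convolution : (ℕ → Carrier) → ℕ → Carrier
  convolution p n = sum {n} λ i → p (toℕ i) * p (n ∸ suc (toℕ i))

  record Recurrence (a b : Carrier) (p : ℕ → Carrier) : Set ℓ where
    constructor recurrence
    field
      initial : p 0 ≈ a
      next    : ∀ n → p (suc n) ≈ b * p n + convolution p n

  open Recurrence

  convolution-cong : ∀ p q n → (∀ i → i < n → p i ≈ q i) → convolution p n ≈ convolution q n
  convolution-cong p q n p≈q = sum-cong-≋ {n} λ i → *-cong
    (p≈q (toℕ i) (Fin.toℕ<n i)) (p≈q (n ∸ suc (toℕ i)) (ℕ.∸-monoʳ-< (s≤s z≤n) (Fin.toℕ<n i)))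

  Recurrence-resp : ∀ {a b p q} → (∀ n → p n ≈ q n) → Recurrence a b p → Recurrence a b q
  Recurrence-resp {p = p} {q} p≈q P = recurrence (trans (sym (p≈q 0)) (initial P)) λ n →
    trans (sym (p≈q (suc n))) (trans (next P n)
      (+-cong (*-congˡ (p≈q n)) (convolution-cong p q n λ i _ → p≈q i)))

  Recurrence-unique : ∀ {a b p q} → Recurrence a b p → Recurrence a b q → ∀ n → p n ≈ q n
  Recurrence-unique {a} {b} {p} {q} P Q n = below (suc n) n ℕ.≤-refl
    where
    below : ∀ m n → n < m → p n ≈ q n
    below (suc m) zero    _         = trans (initial P) (sym (initial Q))
    below (suc m) (suc n) (s≤s n<m) = begin
      p (suc n)                     ≈⟨ next P n ⟩
      b * p n + convolution p n     ≈⟨ +-cong (*-congˡ (below m n n<m))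
                                         (convolution-cong p q n λ i i<n → below m i (ℕ.<-trans i<n n<m)) ⟩
      b * q n + convolution q n     ≈⟨ next Q n ⟨
      q (suc n)                     ∎

  -- The exponent of γ is the size plus one, and (i + 1) + (j + 1) is exactly the exponent for size
  -- i + j + 1. So γ distributes over the convolution with nothing left over, one factor remains for
  -- `b`, and the initial value, of size 1, receives γ².
  Recurrence-scale : ∀ {a b a′ b′ p} γ → γ ^ 2 * a ≈ a′ → γ * b ≈ b′ → Recurrence a b p →
    Recurrence a′ b′ (λ n → γ ^ (suc n ℕ.+ 1) * p n)
  Recurrence-scale {a} {b} {a′} {b′} {p} γ γ²a≈a′ γb≈b′ P =
    recurrence (trans (*-congˡ (initial P)) γ²a≈a′) λ n → begin
      γ * g n * p (suc n)
        ≈⟨ *-congˡ (next P n) ⟩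
      γ * g n * (b * p n + convolution p n)
        ≈⟨ distribˡ _ _ _ ⟩
      γ * g n * (b * p n) + γ * g n * convolution p n
        ≈⟨ +-cong (solve 4 (λ γ g b p → γ :* g :* (b :* p) := γ :* b :* (g :* p)) refl γ (g n) b (p n))
                  (trans (*-distribˡ-sum {n} (γ * g n) _) (sum-cong-≋ {n} λ i → term n (toℕ i) (Fin.toℕ<n i))) ⟩
      γ * b * (g n * p n) + convolution (λ n → g n * p n) n
        ≈⟨ +-congʳ (*-congʳ γb≈b′) ⟩
      b′ * (g n * p n) + convolution (λ n → g n * p n) n ∎
    where
    g : ℕ → Carrier
    g n = γ ^ (suc n ℕ.+ 1)

    exponent : ∀ n i → i < n → suc (suc n ℕ.+ 1) ≡ (suc i ℕ.+ 1) ℕ.+ (suc (n ∸ suc i) ℕ.+ 1)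
    exponent n i i<n = ≡.trans (≡.cong (λ n → suc (suc n ℕ.+ 1)) (≡.sym (ℕ.m+[n∸m]≡n i<n)))
      (ℕS.solve 2 (λ i j → ℕS.con 2 ℕS.:+ (ℕS.con 1 ℕS.:+ i ℕS.:+ j) ℕS.:+ ℕS.con 1
        ℕS.:= (ℕS.con 1 ℕS.:+ i ℕS.:+ ℕS.con 1) ℕS.:+ (ℕS.con 1 ℕS.:+ j ℕS.:+ ℕS.con 1)) ≡.refl i (n ∸ suc i))

    term : ∀ n i → i < n → γ * g n * (p i * p (n ∸ suc i)) ≈ g i * p i * (g (n ∸ suc i) * p (n ∸ suc i))
    term n i i<n = begin
      γ * g n * (p i * p j)     ≈⟨ *-congʳ (trans (^-congʳ γ (exponent n i i<n)) (^-homo-* γ (suc i ℕ.+ 1) (suc j ℕ.+ 1))) ⟩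
      g i * g j * (p i * p j)   ≈⟨ solve 4 (λ a b c d → a :* b :* (c :* d) := a :* c :* (b :* d)) refl _ _ _ _ ⟩
      g i * p i * (g j * p j)   ∎
      where
      j = n ∸ suc i

NonZeroCancellative : CommutativeRing c ℓ → Set (c ⊔ ℓ)
NonZeroCancellative K = AlmostLeftCancellative 0# _*_
  where
  open CommutativeRing K
  open Algebra.Definitions _≈_

record Division (K : CommutativeRing c ℓ) : Set (c ⊔ ℓ) where
  open CommutativeRing K
  field
    _÷_[_]     : ∀ x y → ¬ y ≈ 0# → Carrier
    ÷-*-cancel : ∀ x y y≉0 → (x ÷ y [ y≉0 ]) * y ≈ x

-- Sums over lists

module SumProperties (R : CommutativeRing c ℓ) where
  private
    variable
      A B : Set

  open CommutativeRing R
  open Enumerators R using (∑)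
  open Relation.Binary.Reasoning.Setoid setoid
  open Algebra.Properties.Semiring.Sum semiring using (sum; sum-cong-≋; sum-init-last)

  ∑-cong : ∀ (xs : List A) {f g} → (∀ {x} → x ∈ xs → f x ≈ g x) → ∑ xs f ≈ ∑ xs g
  ∑-cong []       f≈g = refl
  ∑-cong (x ∷ xs) f≈g = +-cong (f≈g (here ≡.refl)) (∑-cong xs (f≈g ∘ there))

  ∑-map : ∀ (h : A → B) xs f → ∑ (map h xs) f ≈ ∑ xs (f ∘ h)
  ∑-map h []       f = refl
  ∑-map h (x ∷ xs) f = +-congˡ (∑-map h xs f)

  ∑-++ : ∀ (xs {ys} : List A) f → ∑ (xs ++ ys) f ≈ ∑ xs f + ∑ ys f
  ∑-++ []       f = sym (+-identityˡ _)
  ∑-++ (x ∷ xs) f = trans (+-congˡ (∑-++ xs f)) (sym (+-assoc _ _ _))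

  ∑-↭ : ∀ {xs ys : List A} f → xs ↭ ys → ∑ xs f ≈ ∑ ys f
  ∑-↭ f xs↭ys = Data.List.Relation.Binary.Permutation.Setoid.Properties.foldr-commMonoid setoid
    +-isCommutativeMonoid (Permutation.map reflexive (↭⇒↭ₛ (map⁺ f xs↭ys)))

  ∑-*-distribˡ : ∀ (xs : List A) f a → ∑ xs (λ x → a * f x) ≈ a * ∑ xs f
  ∑-*-distribˡ []       f a = sym (zeroʳ a)
  ∑-*-distribˡ (x ∷ xs) f a = trans (+-congˡ (∑-*-distribˡ xs f a)) (sym (distribˡ a _ _))

  ∑-cartesianProductWith : ∀ {C : Set} (h : A → B → C) xs ys {f g k} →
    (∀ {x y} → x ∈ xs → y ∈ ys → k (h x y) ≈ f x * g y) →
    ∑ (cartesianProductWith h xs ys) k ≈ ∑ xs f * ∑ ys g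
  ∑-cartesianProductWith h []       ys             k≈fg = sym (zeroˡ _)
  ∑-cartesianProductWith h (x ∷ xs) ys {f} {g} {k} k≈fg = begin
    ∑ (map (h x) ys ++ cartesianProductWith h xs ys) k
      ≈⟨ ∑-++ (map (h x) ys) k ⟩
    ∑ (map (h x) ys) k + ∑ (cartesianProductWith h xs ys) k
      ≈⟨ +-cong (trans (∑-map (h x) ys k) (trans (∑-cong ys (k≈fg (here ≡.refl))) (∑-*-distribˡ ys g (f x))))
                (∑-cartesianProductWith h xs ys (k≈fg ∘ there)) ⟩
    f x * ∑ ys g + ∑ xs f * ∑ ys g
      ≈⟨ distribʳ _ _ _ ⟨
    (f x + ∑ xs f) * ∑ ys g ∎

  ∑-concat-applyUpTo : ∀ (xss : ℕ → List A) m f →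
    ∑ (concat (applyUpTo xss m)) f ≈ sum {m} λ i → ∑ (xss (toℕ i)) f
  ∑-concat-applyUpTo xss zero    f = refl
  ∑-concat-applyUpTo xss (suc m) f =
    trans (∑-++ (xss 0) f) (+-congˡ (∑-concat-applyUpTo (xss ∘ suc) m f))

  sum-last : ∀ n (f : ℕ → Carrier) →
    sum {suc n} (f ∘ toℕ) ≈ sum {n} (f ∘ toℕ) + f n
  sum-last n f = trans (sum-init-last (f ∘ toℕ)) (+-cong
    (sum-cong-≋ {n} λ i → reflexive (≡.cong f (Fin.toℕ-inject₁ i)))
    (reflexive (≡.cong f (Fin.toℕ-fromℕ n))))

-- The recurrence of the generating polynomials

module AvoiderSums (R : CommutativeRing c ℓ) where
  open CommutativeRing R
  open Algebra.Properties.Semiring.Exp semiring using (_^_; ^-homo-*; ^-congʳ)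
  open Algebra.Properties.Semiring.Sum semiring using (sum; sum-cong-≋)
  open Algebra.Solver.Ring.NaturalCoefficients.Default commutativeSemiring
    using (solve; _:=_; _:+_; _:*_; con)
  open Enumerators R
  open SumProperties R
  open ConvolutionRecurrence R
  open Relation.Binary.Reasoning.Setoid setoid

  module _ (y t : Carrier) where

    weight : List ℕ → Carrier
    weight w = y ^ (peaks w ℕ.+ 1) * t ^ (descents w ℕ.+ 1)

    weight-cong : ∀ v w → peaks v ≡ peaks w → descents v ≡ descents w → weight v ≈ weight w
    weight-cong v w p d = *-cong (^-congʳ y (≡.cong (ℕ._+ 1) p)) (^-congʳ t (≡.cong (ℕ._+ 1) d))

    weight-shift : ∀ k w → weight (map (k ℕ.+_) w) ≈ weight w
    weight-shift k w = weight-cong (map (k ℕ.+_) w) w (peaks-shift k w) (descents-shift k w)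

    module _ {n : ℕ} where

      weight-max∷ : ∀ {b β} → All (_< n) (b ∷ β) → weight (n ∷ b ∷ β) ≈ t * weight (b ∷ β)
      weight-max∷ {b} {β} β<n@(b<n ∷ _) = begin
        weight (n ∷ b ∷ β)
          ≈⟨ *-cong (^-congʳ y (≡.cong (ℕ._+ 1) (peaks-max∷ β<n)))
                    (^-congʳ t (≡.cong (ℕ._+ 1) (descents-max∷ β b<n))) ⟩
        y ^ (peaks (b ∷ β) ℕ.+ 1) * (t * t ^ (descents (b ∷ β) ℕ.+ 1))
          ≈⟨ solve 3 (λ a t b → a :* (t :* b) := t :* (a :* b)) refl _ _ _ ⟩
        t * weight (b ∷ β) ∎

      weight-++-max : ∀ {a α} → All (_< n) (a ∷ α) → weight (a ∷ α ++ n ∷ []) ≈ weight (a ∷ α)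
      weight-++-max {a} {α} α<n = weight-cong (a ∷ α ++ n ∷ []) (a ∷ α) (peaks-++-max α<n)
        (≡.trans (descents-++-max [] α<n) (ℕ.+-identityʳ _))

      -- The peak and the descent at `n` supply the second of the two units in (j + 1) + (k + 1),
      -- which makes the weight multiplicative.
      weight-++-max-++ : ∀ {a α b β} → All (_< n) (a ∷ α) → All (_< n) (b ∷ β) →
        weight (a ∷ α ++ n ∷ b ∷ β) ≈ weight (a ∷ α) * weight (b ∷ β)
      weight-++-max-++ {a} {α} {b} {β} α<n β<n@(b<n ∷ _) = begin
        weight (a ∷ α ++ n ∷ b ∷ β)
          ≈⟨ *-cong (power y (peaks (a ∷ α)) (peaks (b ∷ β)) (peaks-++-max-++ α<n β<n))
                    (power t (descents (a ∷ α)) (descents (b ∷ β)) (≡.trans (descents-++-max (b ∷ β) α<n) (≡.trans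
                      (≡.cong (descents (a ∷ α) ℕ.+_) (descents-max∷ β b<n)) (ℕ.+-suc (descents (a ∷ α)) _)))) ⟩
        _ ≈⟨ solve 4 (λ a b c d → (a :* b) :* (c :* d) := (a :* c) :* (b :* d)) refl _ _ _ _ ⟩
        weight (a ∷ α) * weight (b ∷ β) ∎
        where
        power : ∀ x j k {i} → i ≡ suc (j ℕ.+ k) → x ^ (i ℕ.+ 1) ≈ x ^ (j ℕ.+ 1) * x ^ (k ℕ.+ 1)
        power x j k ≡.refl = trans
          (^-congʳ x (ℕS.solve 2 (λ j k → ℕS.con 1 ℕS.:+ (j ℕS.:+ k) ℕS.:+ ℕS.con 1
            ℕS.:= (j ℕS.:+ ℕS.con 1) ℕS.:+ (k ℕS.:+ ℕS.con 1)) ≡.refl j k))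
          (^-homo-* x (j ℕ.+ 1) (k ℕ.+ 1))

    total : ℕ → Carrier
    total n = ∑ (avoiders (suc n)) weight

    P≈total : ∀ n → P⁽ᵖᵏ,ᵈᵉˢ⁾ (Av231 (suc n)) y t ≈ total n
    P≈total n = sym (trans (∑-map letters (Av231 (suc n)) weight) (∑-cong (Av231 (suc n)) λ {π} _ →
      *-cong (^-congʳ y (≡.cong (ℕ._+ 1) (peaks-letters π)))
             (^-congʳ t (≡.cong (ℕ._+ 1) (descents-letters π)))))

    private
      bounds : ∀ {k l n α β} → k ℕ.+ l ≡ n → IsAvoider k α → IsAvoider l β →
        All (_< n) (map (length α ℕ.+_) β)
      bounds {k} ≡.refl α-av β-av with IsAvoider.length≡n α-av
      ... | ≡.refl = All.map⁺ (All.map (ℕ.+-monoʳ-< k) (IsAvoider.bounded β-av))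

    -- The largest letter comes first, adding a descent but no peak. The empty first part thus
    -- counts as `t` rather than as its own weight, which is why this block is kept out of the
    -- convolution.
    joins-first : ∀ n → ∑ (joins (suc n) 0) weight ≈ t * total n
    joins-first n = trans
      (∑-cartesianProductWith (join (suc n)) (avoiders 0) (avoiders (suc n)) {λ _ → t} {weight}
        λ α∈ β∈ → step (∈-avoiders⁻ α∈) (∈-avoiders⁻ β∈))
      (*-congʳ (+-identityʳ t))
      where
      step : ∀ {α β} → IsAvoider 0 α → IsAvoider (suc n) β → weight (join (suc n) α β) ≈ t * weight β
      step {[]} {b ∷ β} α-av β-av =
        trans (weight-max∷ (bounds ≡.refl α-av β-av)) (*-congˡ (weight-shift 0 (b ∷ β)))

    -- The largest letter comes last and adds nothing, so the empty second part counts as 1.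
    joins-last : ∀ n → ∑ (joins (suc n) (suc n)) weight ≈ total n
    joins-last n = trans
      (∑-cartesianProductWith (join (suc n)) (avoiders (suc n)) (avoiders (n ∸ n)) {weight} {λ _ → 1#}
        λ {_} {β} α∈ β∈ → trans
          (step (∈-avoiders⁻ α∈) (≡.subst (λ k → IsAvoider k β) (ℕ.n∸n≡0 n) (∈-avoiders⁻ β∈)))
          (sym (*-identityʳ _)))
      (trans (*-congˡ (trans (reflexive (≡.cong (λ k → ∑ (avoiders k) (λ _ → 1#)) (ℕ.n∸n≡0 n))) (+-identityʳ 1#)))
        (*-identityʳ _))
      where
      step : ∀ {α β} → IsAvoider (suc n) α → IsAvoider 0 β → weight (join (suc n) α β) ≈ weight α
      step {_ ∷ _} {[]} α-av _ = weight-++-max (IsAvoider.bounded α-av)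

    joins-middle : ∀ n i → i < n → ∑ (joins (suc n) (suc i)) weight ≈ total i * total (n ∸ suc i)
    joins-middle n i i<n = trans
      (∑-cartesianProductWith (join (suc n)) (avoiders (suc i)) (avoiders (n ∸ i))
        λ {_} {β} α∈ β∈ →
          step (∈-avoiders⁻ α∈) (≡.subst (λ k → IsAvoider k β) n∸i≡ (∈-avoiders⁻ β∈)))
      (*-congˡ (reflexive (≡.cong (λ k → ∑ (avoiders k) weight) n∸i≡)))
      where
      n∸i≡ : n ∸ i ≡ suc (n ∸ suc i)
      n∸i≡ = ℕ.+-∸-assoc 1 i<n

      step : ∀ {α β} → IsAvoider (suc i) α → IsAvoider (suc (n ∸ suc i)) β →
        weight (join (suc n) α β) ≈ weight α * weight β
      step {a ∷ α} {b ∷ β} α-av β-av = trans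
        (weight-++-max-++
          (All.map (λ a<i → ℕ.<-trans a<i (s≤s i<n)) (IsAvoider.bounded α-av))
          (bounds (≡.trans (ℕ.+-suc (suc i) _) (≡.cong suc (ℕ.m+[n∸m]≡n i<n))) α-av β-av))
        (*-congˡ (weight-shift (length (a ∷ α)) (b ∷ β)))

    -- The blocks with an empty first or second part make up the coefficient 1 + t; those in between
    -- form the convolution.
    total-Recurrence : Recurrence (y * t) (1# + t) total
    total-Recurrence = recurrence
      -- `avoiders 1` evaluates to the list of the single one-letter word.
      (solve 2 (λ y t → (y :* con 1) :* (t :* con 1) :+ con 0 := y :* t) refl y t)
      λ n → begin
        total (suc n)
          ≈⟨ ∑-↭ weight (avoiders-suc (suc n)) ⟩
        ∑ (concat (applyUpTo (joins (suc n)) (suc (suc n)))) weight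
          ≈⟨ ∑-concat-applyUpTo (joins (suc n)) (suc (suc n)) weight ⟩
        ∑ (joins (suc n) 0) weight + sum {suc n} (λ i → ∑ (joins (suc n) (suc (toℕ i))) weight)
          ≈⟨ +-cong (joins-first n) (trans (sum-last n λ i → ∑ (joins (suc n) (suc i)) weight)
               (+-cong (sum-cong-≋ {n} λ i → joins-middle n (toℕ i) (Fin.toℕ<n i)) (joins-last n))) ⟩
        t * total n + (convolution total n + total n)
          ≈⟨ solve 3 (λ t p s → t :* p :+ (s :+ p) := (con 1 :+ t) :* p :+ s) refl _ _ _ ⟩
        (1# + t) * total n + convolution total n ∎

  P-Recurrence : ∀ y t → Recurrence (y * t) (1# + t) (λ n → P⁽ᵖᵏ,ᵈᵉˢ⁾ (Av231 (suc n)) y t)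
  P-Recurrence y t = Recurrence-resp (λ n → sym (P≈total y t n)) (total-Recurrence y t)

  Narayana-Recurrence : ∀ t → Recurrence t (1# + t) (λ n → Narayana (suc n) t)
  Narayana-Recurrence t = recurrence (trans (initial P) (*-identityˡ t)) (next P)
    where
    open Recurrence
    1^ : ∀ n → 1# ^ n ≈ 1#
    1^ zero    = refl
    1^ (suc n) = trans (*-identityˡ _) (1^ n)
    P : Recurrence (1# * t) (1# + t) (λ n → Narayana (suc n) t)
    P = Recurrence-resp (λ n → ∑-cong (Av231 (suc n)) λ {π} _ → trans (*-congʳ (1^ (pk π ℕ.+ 1))) (*-identityˡ _)) (P-Recurrence 1# t)

-- Division, cancellation and the embedding `ι` for fractions

module FractionField (D : IntegralDomain c ℓ) where
  open IntegralDomain D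
  open Fractions D
  open Relation.Binary.Reasoning.Setoid setoid
  open Algebra.Solver.Ring.NaturalCoefficients.Default commutativeSemiring
    using (solve; _:=_; _:+_; _:*_; con)
  private
    module F = CommutativeRing fractionRing

  ÷-*-cancel : ∀ x y y≉0 → (x ÷ y [ y≉0 ]) *ᶠ y ≈ᶠ x
  ÷-*-cancel x y _ = solve 4 (λ a b c d → (a :* d :* c) :* b := a :* ((b :* c) :* d)) refl
    (numerator x) (denominator x) (numerator y) (denominator y)

  division : Division fractionRing
  division = record { _÷_[_] = _÷_[_] ; ÷-*-cancel = ÷-*-cancel }

  -- After cross-multiplication both sides carry the factor `numerator z * denominator z`, which can
  -- be cancelled in the domain.
  *ᶠ-cancelˡ-nonZero : NonZeroCancellative fractionRing
  *ᶠ-cancelˡ-nonZero z x y z≉0 zx≈zy = *-cancelˡ-nonZero (numerator z * denominator z) _ _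
    (*-nonZero (λ n≈0 → z≉0 (trans (*-identityʳ _) (trans n≈0 (sym (zeroˡ _))))) (denominator≉0 z))
    (trans (shuffle _ _ _ _) (trans zx≈zy (sym (shuffle _ _ _ _))))
    where
    shuffle : ∀ a b x y → a * b * (x * y) ≈ a * x * (b * y)
    shuffle = solve 4 (λ a b x y → a :* b :* (x :* y) := a :* x :* (b :* y)) refl

  ι-cong : ∀ {x y} → x ≈ y → ι x ≈ᶠ ι y
  ι-cong x≈y = *-congʳ x≈y

  ι-1 : ι 1# ≈ᶠ 1ᶠ
  ι-1 = refl

  ι-+ : ∀ x y → ι (x + y) ≈ᶠ ι x +ᶠ ι y
  ι-+ = solve 2 (λ x y → (x :+ y) :* (con 1 :* con 1) := (x :* con 1 :+ y :* con 1) :* con 1) refl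

  ι-* : ∀ x y → ι (x * y) ≈ᶠ ι x *ᶠ ι y
  ι-* = solve 2 (λ x y → (x :* y) :* (con 1 :* con 1) := (x :* y) :* con 1) refl

-- The conditions on γ in both cases

module DomainIdentities (K : CommutativeRing c ℓ) (cancel : NonZeroCancellative K) where
  open CommutativeRing K
  open Algebra.Properties.Ring ring using (+-cancelʳ)
  open Algebra.Properties.Semiring.Exp semiring using (_^_)
  open Relation.Binary.Reasoning.Setoid setoid
  open Algebra.Solver.Ring.NaturalCoefficients.Default commutativeSemiring
    using (solve; _:=_; _:+_; _:*_; con)

  module _ {y t γ T Y} (1+y≉0 : ¬ 1# + y ≈ 0#) (1+yt≉0 : ¬ 1# + y * t ≈ 0#)
    ([y+t][1+yt]≉0 : ¬ (y + t) * (1# + y * t) ≈ 0#)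
    (γ-eq : γ * (1# + y) ≈ 1# + y * t)
    (T-eq : T * (1# + y * t) ≈ y + t)
    (Y-eq : Y * ((y + t) * (1# + y * t)) ≈ (1# + y) ^ 2 * t) where

    -- Cleared of denominators, this is (1 + yt) + (y + t) = (1 + y)(1 + t).
    γ[1+T]≈1+t : γ * (1# + T) ≈ 1# + t
    γ[1+T]≈1+t = cancel (1# + y) _ _ 1+y≉0 (begin
      (1# + y) * (γ * (1# + T))              ≈⟨ solve 3 (λ w γ T → w :* (γ :* (con 1 :+ T)) := γ :* w :* (con 1 :+ T)) refl _ _ _ ⟩
      γ * (1# + y) * (1# + T)                ≈⟨ *-congʳ γ-eq ⟩
      (1# + y * t) * (1# + T)                ≈⟨ solve 2 (λ w T → w :* (con 1 :+ T) := w :+ T :* w) refl _ _ ⟩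
      1# + y * t + T * (1# + y * t)          ≈⟨ +-congˡ T-eq ⟩
      1# + y * t + (y + t)                   ≈⟨ solve 2 (λ y t → con 1 :+ y :* t :+ (y :+ t) := (con 1 :+ y) :* (con 1 :+ t)) refl _ _ ⟩
      (1# + y) * (1# + t)                    ∎)

    -- The square of γ calls for the factor 1 + y twice and Y for `m`; what is left of the numerator
    -- of γ² after clearing T combines with y + t to give `m` again.
    γ²YT≈t : γ ^ 2 * (Y * T) ≈ t
    γ²YT≈t = cancel m _ _ [y+t][1+yt]≉0 (cancel (1# + y) _ _ 1+y≉0 (cancel (1# + y) _ _ 1+y≉0 (begin
      w * (w * (m * (γ ^ 2 * (Y * T))))
        ≈⟨ solve 5 (λ w m γ Y T → w :* (w :* (m :* ((γ :* (γ :* con 1)) :* (Y :* T))))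
             := γ :* w :* (γ :* w) :* (Y :* m :* T)) refl _ _ _ _ _ ⟩
      γ * w * (γ * w) * (Y * m * T)
        ≈⟨ *-cong (*-cong γ-eq γ-eq) (*-congʳ Y-eq) ⟩
      x * x * (w ^ 2 * t * T)
        ≈⟨ solve 4 (λ x w t T → x :* x :* ((w :* (w :* con 1)) :* t :* T) := w :* (w :* (T :* x :* x :* t))) refl _ _ _ _ ⟩
      w * (w * (T * x * x * t))
        ≈⟨ *-congˡ (*-congˡ (*-congʳ (*-congʳ T-eq))) ⟩
      w * (w * (m * t)) ∎)))
      where
      m = (y + t) * (1# + y * t)
      w = 1# + y
      x = 1# + y * t

  -- Here a = 2(1 − y)t and b = 2yt are the denominators of u and v, m and n are
  -- their numerators, and d = s + t − 1, d′ = s + 1 − t, e = 1 + t − s.  All are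
  -- given by equations without subtraction, within reach of the semiring solver.
  -- The factorisations 2a = dd′, 2b = e(1 + t + s), a(1 + u) = sd and
  -- b(1 + v) = (1 + t)e reduce everything to identities between the factors.
  module _ {t s a b d d′ e m n u v}
    (2≉0 : ¬ 1# + 1# ≈ 0#) (a≉0 : ¬ a ≈ 0#) (b≉0 : ¬ b ≈ 0#)
    (a+b≈2t : a + b ≈ t + t) (s²+2b≈[1+t]² : s * s + (b + b) ≈ (1# + t) * (1# + t))
    (d-eq : d + 1# ≈ s + t) (d′-eq : d′ + t ≈ s + 1#) (e-eq : e + s ≈ 1# + t)
    (m-eq : m + (b + s) ≈ 1# + t * t + t * s)
    (n-eq : n + (b + (1# + t) * s) ≈ (1# + t) * (1# + t))
    (u-eq : u * a ≈ m) (v-eq : v * b ≈ n) where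

    private
      q = 1# + t

      m+a≈sd : m + a ≈ s * d
      -- Adding `b + s + b` turns the differences inside `m` and `d` into sums and produces the 2b
      -- that the equation of `s` requires.
      m+a≈sd = +-cancelʳ (b + s + b) _ _ (begin
        m + a + (b + s + b)            ≈⟨ solve 4 (λ m a b s → m :+ a :+ (b :+ s :+ b) := (m :+ (b :+ s)) :+ (a :+ b)) refl _ _ _ _ ⟩
        (m + (b + s)) + (a + b)        ≈⟨ +-cong m-eq a+b≈2t ⟩
        1# + t * t + t * s + (t + t)   ≈⟨ solve 2 (λ t s → con 1 :+ t :* t :+ t :* s :+ (t :+ t) := (con 1 :+ t) :* (con 1 :+ t) :+ s :* t) refl _ _ ⟩
        q * q + s * t                  ≈⟨ +-congʳ s²+2b≈[1+t]² ⟨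
        s * s + (b + b) + s * t        ≈⟨ solve 3 (λ s t b → s :* s :+ (b :+ b) :+ s :* t := s :* (s :+ t) :+ (b :+ b)) refl _ _ _ ⟩
        s * (s + t) + (b + b)          ≈⟨ +-congʳ (*-congˡ d-eq) ⟨
        s * (d + 1#) + (b + b)         ≈⟨ solve 3 (λ s d b → s :* (d :+ con 1) :+ (b :+ b) := s :* d :+ (b :+ s :+ b)) refl _ _ _ ⟩
        s * d + (b + s + b)            ∎)

      n+b≈qe : n + b ≈ q * e
      n+b≈qe = +-cancelʳ (q * s) _ _ (begin
        n + b + q * s       ≈⟨ +-assoc _ _ _ ⟩
        n + (b + q * s)     ≈⟨ n-eq ⟩
        q * q               ≈⟨ *-congˡ e-eq ⟨
        q * (e + s)         ≈⟨ distribˡ _ _ _ ⟩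
        q * e + q * s       ∎)

      -- A difference of squares: dd′ = s² - (1 - t)² = 4t - 2b.
      2a≈dd′ : a + a ≈ d * d′
      2a≈dd′ = +-cancelʳ (b + b + (d + 1#) * t + (d′ + t)) _ _ (begin
        a + a + (b + b + (d + 1#) * t + (d′ + t))
          ≈⟨ solve 5 (λ a b t D E → a :+ a :+ (b :+ b :+ D :* t :+ E)
               := (a :+ b) :+ (a :+ b) :+ D :* t :+ E) refl _ _ _ _ _ ⟩
        (a + b) + (a + b) + (d + 1#) * t + (d′ + t)
          ≈⟨ +-cong (+-cong (+-cong a+b≈2t a+b≈2t) (*-congʳ d-eq)) d′-eq ⟩
        (t + t) + (t + t) + (s + t) * t + (s + 1#)
          ≈⟨ solve 2 (λ s t → (t :+ t) :+ (t :+ t) :+ (s :+ t) :* t :+ (s :+ con 1)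
               := (con 1 :+ t) :* (con 1 :+ t) :+ (s :* t :+ s :+ t) :+ t) refl _ _ ⟩
        q * q + (s * t + s + t) + t
          ≈⟨ +-congʳ (+-congʳ s²+2b≈[1+t]²) ⟨
        s * s + (b + b) + (s * t + s + t) + t
          ≈⟨ solve 3 (λ s t b → s :* s :+ (b :+ b) :+ (s :* t :+ s :+ t) :+ t
               := (s :+ t) :* (s :+ con 1) :+ (b :+ b) :+ t) refl _ _ _ ⟩
        (s + t) * (s + 1#) + (b + b) + t
          ≈⟨ +-congʳ (+-congʳ (*-cong d-eq d′-eq)) ⟨
        (d + 1#) * (d′ + t) + (b + b) + t
          ≈⟨ solve 4 (λ d d′ t b → (d :+ con 1) :* (d′ :+ t) :+ (b :+ b) :+ t
               := d :* d′ :+ (b :+ b :+ (d :+ con 1) :* t :+ (d′ :+ t))) refl _ _ _ _ ⟩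
        d * d′ + (b + b + (d + 1#) * t + (d′ + t)) ∎)

      -- Again a difference of squares: 2b = q² - s².
      2b≈e[q+s] : b + b ≈ e * (q + s)
      2b≈e[q+s] = +-cancelʳ (s * s) _ _ (begin
        b + b + s * s             ≈⟨ +-comm _ _ ⟩
        s * s + (b + b)           ≈⟨ s²+2b≈[1+t]² ⟩
        q * q                     ≈⟨ *-congʳ e-eq ⟨
        (e + s) * q               ≈⟨ distribʳ _ _ _ ⟩
        e * q + s * q             ≈⟨ +-congˡ (*-congˡ e-eq) ⟨
        e * q + s * (e + s)       ≈⟨ solve 3 (λ e q s → e :* q :+ s :* (e :+ s) := e :* (q :+ s) :+ s :* s) refl _ _ _ ⟩
        e * (q + s) + s * s       ∎)

      halve : ∀ {x y} → x + x ≈ y + y → x ≈ y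
      halve {x} {y} 2x≈2y = cancel (1# + 1#) _ _ 2≉0 (trans (double x) (trans 2x≈2y (sym (double y))))
        where
        double : ∀ x → (1# + 1#) * x ≈ x + x
        double = solve 1 (λ x → (con 1 :+ con 1) :* x := x :+ x) refl

      -- This is ab(1 + uv). Expanding (m + a)(n + b) expresses it by the known factorisations;
      -- after doubling, de·s(q - s + d′) remains, and q - s + d′ = 2.
      ab+mn≈sde : a * b + m * n ≈ s * d * e
      ab+mn≈sde = +-cancelʳ (s * d * b + a * (q * e)) _ _ (begin
        a * b + m * n + (s * d * b + a * (q * e))
          ≈⟨ +-congˡ (+-cong (*-congʳ m+a≈sd) (*-congˡ n+b≈qe)) ⟨
        a * b + m * n + ((m + a) * b + a * (n + b))
          ≈⟨ solve 4 (λ a b m n → a :* b :+ m :* n :+ ((m :+ a) :* b :+ a :* (n :+ b))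
               := (m :+ a) :* (n :+ b) :+ (a :* b :+ a :* b)) refl _ _ _ _ ⟩
        (m + a) * (n + b) + (a * b + a * b)
          ≈⟨ +-congʳ (*-cong m+a≈sd n+b≈qe) ⟩
        s * d * (q * e) + (a * b + a * b)
          ≈⟨ halve doubled ⟩
        s * d * e + (s * d * b + a * (q * e)) ∎)
        where
        doubled : s * d * (q * e) + (a * b + a * b) + (s * d * (q * e) + (a * b + a * b))
          ≈ s * d * e + (s * d * b + a * (q * e)) + (s * d * e + (s * d * b + a * (q * e)))
        doubled = begin
          s * d * (q * e) + (a * b + a * b) + (s * d * (q * e) + (a * b + a * b))
            ≈⟨ solve 6 (λ s d q e a b →
                 s :* d :* (q :* e) :+ (a :* b :+ a :* b) :+ (s :* d :* (q :* e) :+ (a :* b :+ a :* b))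
                 := s :* d :* (q :* e) :+ s :* d :* (q :* e) :+ (a :+ a) :* (b :+ b)) refl _ _ _ _ _ _ ⟩
          s * d * (q * e) + s * d * (q * e) + (a + a) * (b + b)
            ≈⟨ +-congˡ (*-cong 2a≈dd′ 2b≈e[q+s]) ⟩
          s * d * (q * e) + s * d * (q * e) + d * d′ * (e * (q + s))
            ≈⟨ solve 5 (λ s d d′ t e → let q = con 1 :+ t in
                 s :* d :* (q :* e) :+ s :* d :* (q :* e) :+ d :* d′ :* (e :* (q :+ s))
                 := d :* e :* (d′ :* q :+ s :* (con 2 :+ t :+ (d′ :+ t)))) refl _ _ _ _ _ ⟩
          d * e * (d′ * q + s * (1# + 1# + t + (d′ + t)))
            ≈⟨ *-congˡ (+-congˡ (*-congˡ (+-congˡ d′-eq))) ⟩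
          d * e * (d′ * q + s * (1# + 1# + t + (s + 1#)))
            ≈⟨ solve 5 (λ s d d′ t e → let q = con 1 :+ t in
                 d :* e :* (d′ :* q :+ s :* (con 2 :+ t :+ (s :+ con 1)))
                 := s :* d :* e :+ s :* d :* e :+ s :* d :* (e :* (q :+ s)) :+ d :* d′ :* (q :* e)) refl _ _ _ _ _ ⟩
          s * d * e + s * d * e + s * d * (e * (q + s)) + d * d′ * (q * e)
            ≈⟨ +-cong (+-congˡ (*-congˡ 2b≈e[q+s])) (*-congʳ 2a≈dd′) ⟨
          s * d * e + s * d * e + s * d * (b + b) + (a + a) * (q * e)
            ≈⟨ solve 6 (λ s d q e a b →
                 s :* d :* e :+ s :* d :* e :+ s :* d :* (b :+ b) :+ (a :+ a) :* (q :* e)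
                 := s :* d :* e :+ (s :* d :* b :+ a :* (q :* e)) :+ (s :* d :* e :+ (s :* d :* b :+ a :* (q :* e))))
                 refl _ _ _ _ _ _ ⟩
          s * d * e + (s * d * b + a * (q * e)) + (s * d * e + (s * d * b + a * (q * e))) ∎

      -- With n = qe - b one gets 2n = e(2q - (q + s)) = e(q - s).
      2n≈ee : n + n ≈ e * e
      2n≈ee = +-cancelʳ (b + b) _ _ (begin
        n + n + (b + b)         ≈⟨ solve 2 (λ n b → n :+ n :+ (b :+ b) := (n :+ b) :+ (n :+ b)) refl _ _ ⟩
        (n + b) + (n + b)       ≈⟨ +-cong n+b≈qe n+b≈qe ⟩
        q * e + q * e           ≈⟨ distribʳ e q q ⟨
        (q + q) * e             ≈⟨ *-congʳ (+-congˡ e-eq) ⟨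
        (q + (e + s)) * e       ≈⟨ solve 3 (λ q e s → (q :+ (e :+ s)) :* e := e :* e :+ e :* (q :+ s)) refl _ _ _ ⟩
        e * e + e * (q + s)     ≈⟨ +-congˡ 2b≈e[q+s] ⟨
        e * e + (b + b)         ∎)

      b[1+v]≈qe : b * (1# + v) ≈ q * e
      b[1+v]≈qe = begin
        b * (1# + v)       ≈⟨ solve 2 (λ b v → b :* (con 1 :+ v) := v :* b :+ b) refl _ _ ⟩
        v * b + b          ≈⟨ +-congʳ v-eq ⟩
        n + b              ≈⟨ n+b≈qe ⟩
        q * e              ∎

    -- Multiplied by ab, both sides become q · sde.
    [1+u][1+v]≈[1+t][1+uv] : (1# + u) * (1# + v) ≈ (1# + t) * (1# + u * v)
    [1+u][1+v]≈[1+t][1+uv] = cancel a _ _ a≉0 (cancel b _ _ b≉0 (begin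
      b * (a * ((1# + u) * (1# + v)))     ≈⟨ solve 4 (λ a b u v → b :* (a :* ((con 1 :+ u) :* (con 1 :+ v))) := (u :* a :+ a) :* (b :* (con 1 :+ v))) refl _ _ _ _ ⟩
      (u * a + a) * (b * (1# + v))        ≈⟨ *-cong (trans (+-congʳ u-eq) m+a≈sd) b[1+v]≈qe ⟩
      s * d * (q * e)                     ≈⟨ solve 4 (λ s d q e → s :* d :* (q :* e) := q :* (s :* d :* e)) refl _ _ _ _ ⟩
      q * (s * d * e)                     ≈⟨ *-congˡ ab+mn≈sde ⟨
      q * (a * b + m * n)                 ≈⟨ *-congˡ (+-congˡ (*-cong u-eq v-eq)) ⟨
      q * (a * b + u * a * (v * b))       ≈⟨ solve 5 (λ q a b u v → q :* (a :* b :+ u :* a :* (v :* b)) := b :* (a :* (q :* (con 1 :+ u :* v)))) refl _ _ _ _ _ ⟩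
      b * (a * (q * (1# + u * v)))        ∎))

    -- For b = 2yt this is twice the quadratic equation of v; multiplied by b, both sides are q²e².
    2v[1+t]²≈b[1+v]² : (v + v) * ((1# + t) * (1# + t)) ≈ b * ((1# + v) * (1# + v))
    2v[1+t]²≈b[1+v]² = cancel b _ _ b≉0 (begin
      b * ((v + v) * (q * q))                ≈⟨ solve 3 (λ b v q → b :* ((v :+ v) :* (q :* q)) := (v :* b :+ v :* b) :* (q :* q)) refl _ _ _ ⟩
      (v * b + v * b) * (q * q)              ≈⟨ *-congʳ (trans (+-cong v-eq v-eq) 2n≈ee) ⟩
      e * e * (q * q)                        ≈⟨ solve 2 (λ e q → e :* e :* (q :* q) := q :* e :* (q :* e)) refl _ _ ⟩
      q * e * (q * e)                        ≈⟨ *-cong b[1+v]≈qe b[1+v]≈qe ⟨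
      b * (1# + v) * (b * (1# + v))          ≈⟨ solve 2 (λ b w → b :* w :* (b :* w) := b :* (b :* (w :* w))) refl _ _ ⟩
      b * (b * ((1# + v) * (1# + v)))        ∎)

    module _ {y γ} (1+t≉0 : ¬ 1# + t ≈ 0#) (1+uv≉0 : ¬ 1# + u * v ≈ 0#)
      (b≈2yt : b ≈ y * t + y * t) (γ-eq : γ * (1# + u * v) ≈ 1# + u) where

      γ[1+v]≈1+t : γ * (1# + v) ≈ 1# + t
      γ[1+v]≈1+t = cancel (1# + u * v) _ _ 1+uv≉0 (begin
        (1# + u * v) * (γ * (1# + v))     ≈⟨ solve 3 (λ w γ x → w :* (γ :* x) := γ :* w :* x) refl _ _ _ ⟩
        γ * (1# + u * v) * (1# + v)       ≈⟨ *-congʳ γ-eq ⟩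
        (1# + u) * (1# + v)               ≈⟨ [1+u][1+v]≈[1+t][1+uv] ⟩
        (1# + t) * (1# + u * v)           ≈⟨ *-comm _ _ ⟩
        (1# + u * v) * (1# + t)           ∎)

      γ²v≈yt : γ ^ 2 * v ≈ y * t
      γ²v≈yt = halve (cancel q _ _ 1+t≉0 (cancel q _ _ 1+t≉0 (begin
        q * (q * (γ ^ 2 * v + γ ^ 2 * v))
          ≈⟨ solve 3 (λ q γ v → q :* (q :* ((γ :* (γ :* con 1)) :* v :+ (γ :* (γ :* con 1)) :* v))
               := γ :* γ :* ((v :+ v) :* (q :* q))) refl _ _ _ ⟩
        γ * γ * ((v + v) * (q * q))
          ≈⟨ *-congˡ 2v[1+t]²≈b[1+v]² ⟩
        γ * γ * (b * ((1# + v) * (1# + v)))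
          ≈⟨ solve 3 (λ γ b w → γ :* γ :* (b :* (w :* w)) := γ :* w :* (γ :* w) :* b) refl _ _ _ ⟩
        γ * (1# + v) * (γ * (1# + v)) * b
          ≈⟨ *-cong (*-cong γ[1+v]≈1+t γ[1+v]≈1+t) b≈2yt ⟩
        q * q * (y * t + y * t)
          ≈⟨ *-assoc _ _ _ ⟩
        q * (q * (y * t + y * t)) ∎)))

-- Both formulas, with the quotients given by their defining equations

module DomainTheorem (K : CommutativeRing c ℓ) (cancel : NonZeroCancellative K) where
  open CommutativeRing K
  open Algebra.Properties.Semiring.Exp semiring using (_^_)
  open Algebra.Solver.Ring.NaturalCoefficients.Default commutativeSemiring
    using (solve; _:=_; _:+_; _:*_; con)
  open Relation.Binary.Reasoning.Setoid setoid
  open DomainIdentities K cancel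
  open ConvolutionRecurrence K
  open AvoiderSums K
  open Enumerators K

  Narayana≈P : ∀ {y t γ T Y} n →
    ¬ 1# + y ≈ 0# → ¬ 1# + y * t ≈ 0# → ¬ (y + t) * (1# + y * t) ≈ 0# →
    γ * (1# + y) ≈ 1# + y * t →
    T * (1# + y * t) ≈ y + t →
    Y * ((y + t) * (1# + y * t)) ≈ (1# + y) ^ 2 * t →
    Narayana (suc n) t ≈ γ ^ (suc n ℕ.+ 1) * P⁽ᵖᵏ,ᵈᵉˢ⁾ (Av231 (suc n)) Y T
  Narayana≈P {t = t} {γ} {T} {Y} n 1+y≉0 1+yt≉0 [y+t][1+yt]≉0 γ-eq T-eq Y-eq =
    Recurrence-unique (Narayana-Recurrence t)
      (Recurrence-scale γ
        (γ²YT≈t 1+y≉0 1+yt≉0 [y+t][1+yt]≉0 γ-eq T-eq Y-eq)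
        (γ[1+T]≈1+t 1+y≉0 1+yt≉0 [y+t][1+yt]≉0 γ-eq T-eq Y-eq)
        (P-Recurrence Y T))
      n

  private
    2# : Carrier
    2# = 1# + 1#

    x-y+y≈x : ∀ x y → x - y + y ≈ x
    x-y+y≈x x y = trans (+-assoc x (- y) y) (trans (+-congˡ (-‿inverseˡ y)) (+-identityʳ x))

  P≈Narayana : ∀ {y t s u v γ} n →
    ¬ 2# ≈ 0# → ¬ 1# + t ≈ 0# → ¬ 2# * (1# - y) * t ≈ 0# → ¬ 2# * y * t ≈ 0# → ¬ 1# + u * v ≈ 0# →
    s * s + (2# * y * t + 2# * y * t) ≈ (1# + t) * (1# + t) →
    u * (2# * (1# - y) * t) ≈ 1# + t ^ 2 - 2# * y * t - (1# - t) * s →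
    v * (2# * y * t) ≈ (1# + t) ^ 2 - 2# * y * t - (1# + t) * s →
    γ * (1# + u * v) ≈ 1# + u →
    P⁽ᵖᵏ,ᵈᵉˢ⁾ (Av231 (suc n)) y t ≈ γ ^ (suc n ℕ.+ 1) * Narayana (suc n) v
  P≈Narayana {y} {t} {s} {u} {v} {γ} n 2≉0 1+t≉0 a≉0 b≉0 1+uv≉0 s²-eq u-eq v-eq γ-eq =
    Recurrence-unique (P-Recurrence y t)
      (Recurrence-scale γ
        (γ²v≈yt {d = d} {d′} {e} 2≉0 a≉0 b≉0 a+b≈2t s²-eq d-eq d′-eq e-eq m-eq n-eq u-eq v-eq
          1+t≉0 1+uv≉0 b≈2yt γ-eq)
        (γ[1+v]≈1+t {d = d} {d′} {e} 2≉0 a≉0 b≉0 a+b≈2t s²-eq d-eq d′-eq e-eq m-eq n-eq u-eq v-eq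
          1+t≉0 1+uv≉0 b≈2yt γ-eq)
        (Narayana-Recurrence v))
      n
    where
    a  = 2# * (1# - y) * t
    b  = 2# * y * t
    m  = 1# + t ^ 2 - b - (1# - t) * s
    n′ = (1# + t) ^ 2 - b - (1# + t) * s
    d  = s + t - 1#
    d′ = s + 1# - t
    e  = 1# + t - s

    d-eq : d + 1# ≈ s + t
    d-eq = x-y+y≈x (s + t) 1#

    d′-eq : d′ + t ≈ s + 1#
    d′-eq = x-y+y≈x (s + 1#) t

    e-eq : e + s ≈ 1# + t
    e-eq = x-y+y≈x (1# + t) s

    b≈2yt : b ≈ y * t + y * t
    b≈2yt = solve 2 (λ y t → (con 1 :+ con 1) :* y :* t := y :* t :+ y :* t) refl y t

    a+b≈2t : a + b ≈ t + t
    a+b≈2t = begin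
      a + b                        ≈⟨ solve 3 (λ z y t → (con 1 :+ con 1) :* z :* t :+ (con 1 :+ con 1) :* y :* t
                                       := (z :+ y) :* t :+ (z :+ y) :* t) refl (1# - y) y t ⟩
      (1# - y + y) * t + (1# - y + y) * t ≈⟨ +-cong 1-y+y 1-y+y ⟩
      t + t                        ∎
      where
      1-y+y : (1# - y + y) * t ≈ t
      1-y+y = trans (*-congʳ (x-y+y≈x 1# y)) (*-identityˡ t)

    m-eq : m + (b + s) ≈ 1# + t * t + t * s
    m-eq = begin
      m + (b + s)
        -- Writing s as (1 - t + t)s provides the term (1 - t)s that is subtracted in `m`.
        ≈⟨ +-congˡ (+-congˡ (trans (sym (*-identityˡ s)) (*-congʳ (sym (x-y+y≈x 1# t))))) ⟩
      m + (b + (1# - t + t) * s)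
        ≈⟨ solve 5 (λ m b w t s → m :+ (b :+ (w :+ t) :* s) := m :+ w :* s :+ b :+ t :* s) refl m b (1# - t) t s ⟩
      m + (1# - t) * s + b + t * s
        ≈⟨ +-congʳ (trans (+-congʳ (x-y+y≈x _ _)) (x-y+y≈x _ b)) ⟩
      1# + t ^ 2 + t * s
        ≈⟨ +-congʳ (+-congˡ (*-congˡ (*-identityʳ t))) ⟩
      1# + t * t + t * s ∎

    n-eq : n′ + (b + (1# + t) * s) ≈ (1# + t) * (1# + t)
    n-eq = begin
      n′ + (b + (1# + t) * s)
        ≈⟨ solve 3 (λ n b w → n :+ (b :+ w) := n :+ w :+ b) refl n′ b _ ⟩
      n′ + (1# + t) * s + b
        ≈⟨ trans (+-congʳ (x-y+y≈x _ _)) (x-y+y≈x _ b) ⟩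
      (1# + t) ^ 2
        ≈⟨ *-congˡ (*-identityʳ _) ⟩
      (1# + t) * (1# + t) ∎

-- The equation of the square root in the field of fractions

module RadicandImage (D : CommutativeRing c ℓ) (K : CommutativeRing c′ ℓ′) where
  private
    module D = CommutativeRing D
  open CommutativeRing K
  open Algebra.Solver.Ring.NaturalCoefficients.Default commutativeSemiring
    using (solve; _:=_; _:+_; _:*_; con)
  open Relation.Binary.Reasoning.Setoid setoid

  module _ (ι : D.Carrier → Carrier) (ι-cong : ∀ {x y} → x D.≈ y → ι x ≈ ι y)
    (ι-1 : ι D.1# ≈ 1#)
    (ι-+ : ∀ x y → ι (x D.+ y) ≈ ι x + ι y) (ι-* : ∀ x y → ι (x D.* y) ≈ ι x * ι y) where

    private
      2# : Carrier
      2# = 1# + 1#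

    -- The subtracted term is added back inside `D`, so it is enough that `ι` respects 1, sums and
    -- products.
    ι-radicand : ∀ y t s →
      s D.* s D.≈ (D.1# D.+ t) D.* (D.1# D.+ t) D.- ((D.1# D.+ D.1#) D.+ (D.1# D.+ D.1#)) D.* y D.* t →
      ι s * ι s + (2# * ι y * ι t + 2# * ι y * ι t) ≈ (1# + ι t) * (1# + ι t)
    ι-radicand y t s s²≈ = begin
      ι s * ι s + (2# * ι y * ι t + 2# * ι y * ι t)
        ≈⟨ +-cong (sym (ι-* s s)) (sym ι-4yt) ⟩
      ι (s D.* s) + ι 4yt
        ≈⟨ ι-+ _ _ ⟨
      ι (s D.* s D.+ 4yt)
        ≈⟨ ι-cong (D.trans (D.+-congʳ s²≈) (D.trans (D.+-assoc _ _ _)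
             (D.trans (D.+-congˡ (D.-‿inverseˡ 4yt)) (D.+-identityʳ _)))) ⟩
      ι ((D.1# D.+ t) D.* (D.1# D.+ t))
        ≈⟨ ι-* _ _ ⟩
      ι (D.1# D.+ t) * ι (D.1# D.+ t)
        ≈⟨ *-cong ι-1+t ι-1+t ⟩
      (1# + ι t) * (1# + ι t) ∎
      where
      4yt = ((D.1# D.+ D.1#) D.+ (D.1# D.+ D.1#)) D.* y D.* t

      ι-4yt : ι 4yt ≈ 2# * ι y * ι t + 2# * ι y * ι t
      ι-4yt = begin
        ι 4yt
          ≈⟨ trans (ι-* _ _) (*-congʳ (trans (ι-* _ _) (*-congʳ (trans (ι-+ _ _) (+-cong ι-2 ι-2))))) ⟩
        (2# + 2#) * ι y * ι t
          ≈⟨ solve 3 (λ z y t → (z :+ z) :* y :* t := z :* y :* t :+ z :* y :* t) refl 2# (ι y) (ι t) ⟩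
        2# * ι y * ι t + 2# * ι y * ι t ∎
        where
        ι-2 : ι (D.1# D.+ D.1#) ≈ 2#
        ι-2 = trans (ι-+ _ _) (+-cong ι-1 ι-1)

      ι-1+t : ι (D.1# D.+ t) ≈ 1# + ι t
      ι-1+t = trans (ι-+ _ _) (+-congʳ ι-1)

-- Comparing two formulas over a concrete field of fractions by computation is
-- infeasible.  The records are therefore indexed by the operations: Agda then
-- compares only the operations when one formula is converted into the other.
module Identities {C : Set c} (_≈_ : C → C → Set ℓ) (_+_ _-_ _*_ : C → C → C) (0# 1# : C)
  (_^_ : C → ℕ → C) (_÷_[_] : (x y : C) → ¬ (y ≈ 0#) → C)
  (N : ℕ → C → C) (P : {n : ℕ} → List (Word n n) → C → C → C) where

  record NarayanaFromP : Set (c ⊔ ℓ) where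
    field
      formula : ∀ y t n 1+y≉0 1+yt≉0 [y+t][1+yt]≉0 →
        N (suc n) t ≈
          ((((1# + (y * t)) ÷ (1# + y) [ 1+y≉0 ]) ^ (suc n ℕ.+ 1))
          * P (Av231 (suc n))
              ((((1# + y) ^ 2) * t) ÷ ((y + t) * (1# + (y * t))) [ [y+t][1+yt]≉0 ])
              ((y + t) ÷ (1# + (y * t)) [ 1+yt≉0 ]))

  -- With `u` a variable, matching on the equation puts the quotient into the abstract proof, while
  -- an instance of the formula mentions only `u`.
  record ExpressionU (2# y t s u : C) : Set (c ⊔ ℓ) where
    field
      denominator≉0 : ¬ (((2# * (1# - y)) * t) ≈ 0#)
      equation : u ≡ ((((1# + (t ^ 2)) - ((2# * y) * t)) - ((1# - t) * s))
        ÷ ((2# * (1# - y)) * t) [ denominator≉0 ])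

  record ExpressionV (2# y t s v : C) : Set (c ⊔ ℓ) where
    field
      denominator≉0 : ¬ (((2# * y) * t) ≈ 0#)
      equation : v ≡ (((((1# + t) ^ 2) - ((2# * y) * t)) - ((1# + t) * s))
        ÷ ((2# * y) * t) [ denominator≉0 ])

  -- The square root is known through its square in `D`, hence the elements y₀, t₀, s₀ of `D` beside
  -- their images.
  record PFromNarayana (D : CommutativeRing c′ ℓ′) (ι : CommutativeRing.Carrier D → C) :
    Set (c ⊔ ℓ ⊔ c′ ⊔ ℓ′) where
    private module D = CommutativeRing D
    field
      formula : ∀ {2# y t s u v} y₀ t₀ s₀ n → 2# ≡ (1# + 1#) → y ≡ ι y₀ → t ≡ ι t₀ → s ≡ ι s₀ →
        s₀ D.* s₀ D.≈ (D.1# D.+ t₀) D.* (D.1# D.+ t₀) D.- ((D.1# D.+ D.1#) D.+ (D.1# D.+ D.1#)) D.* y₀ D.* t₀ →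
        ¬ (2# ≈ 0#) → ¬ ((1# + t) ≈ 0#) → ExpressionU 2# y t s u → ExpressionV 2# y t s v → ∀ 1+uv≉0 →
        P (Av231 (suc n)) y t ≈ ((((1# + u) ÷ (1# + (u * v)) [ 1+uv≉0 ]) ^ (suc n ℕ.+ 1)) * N (suc n) v)

module DomainFormulas (K : CommutativeRing c ℓ) (cancel : NonZeroCancellative K)
  (division : Division K) where
  open CommutativeRing K
  open Division division
  open Algebra.Properties.Semiring.Exp semiring using (_^_)
  open Enumerators K

  narayanaFromP : Identities.NarayanaFromP _≈_ _+_ _-_ _*_ 0# 1# _^_ _÷_[_] Narayana P⁽ᵖᵏ,ᵈᵉˢ⁾
  narayanaFromP = record { formula = λ y t n p q r → DomainTheorem.Narayana≈P K cancel n p q r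
    (÷-*-cancel _ _ p) (÷-*-cancel _ _ q) (÷-*-cancel _ _ r) }

  module _ (D : CommutativeRing c′ ℓ′) where
    private
      module D = CommutativeRing D

    module _ (ι : D.Carrier → Carrier) (ι-cong : ∀ {x y} → x D.≈ y → ι x ≈ ι y)
      (ι-1 : ι D.1# ≈ 1#)
      (ι-+ : ∀ x y → ι (x D.+ y) ≈ ι x + ι y) (ι-* : ∀ x y → ι (x D.* y) ≈ ι x * ι y) where

      pFromNarayana : Identities.PFromNarayana _≈_ _+_ _-_ _*_ 0# 1# _^_ _÷_[_] Narayana P⁽ᵖᵏ,ᵈᵉˢ⁾ D ι
      pFromNarayana = record { formula = λ
        { y₀ t₀ s₀ n ≡.refl ≡.refl ≡.refl ≡.refl s²-eq 2≉0 1+t≉0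
          record { denominator≉0 = a≉0 ; equation = ≡.refl } record { denominator≉0 = b≉0 ; equation = ≡.refl } 1+uv≉0 →
        DomainTheorem.P≈Narayana K cancel n 2≉0 1+t≉0 a≉0 b≉0 1+uv≉0
          (RadicandImage.ι-radicand D K ι ι-cong ι-1 ι-+ ι-* y₀ t₀ s₀ s²-eq)
          (÷-*-cancel _ _ a≉0) (÷-*-cancel _ _ b≉0) (÷-*-cancel _ _ 1+uv≉0) } }

module FractionFormulas (D : IntegralDomain c ℓ) where
  open Fractions D using (ι; _÷_[_]; fractionRing)
  open FractionField D
  open CommutativeRing fractionRing
  open Algebra.Properties.Semiring.Exp semiring using (_^_)
  open Enumerators fractionRing
  private
    module F = DomainFormulas fractionRing *ᶠ-cancelˡ-nonZero division

  narayanaFromP : Identities.NarayanaFromP _≈_ _+_ _-_ _*_ 0# 1# _^_ _÷_[_] Narayana P⁽ᵖᵏ,ᵈᵉˢ⁾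
  narayanaFromP = F.narayanaFromP

  pFromNarayana : Identities.PFromNarayana _≈_ _+_ _-_ _*_ 0# 1# _^_ _÷_[_] Narayana P⁽ᵖᵏ,ᵈᵉˢ⁾
    (IntegralDomain.commutativeRing D) ι
  pFromNarayana = F.pFromNarayana (IntegralDomain.commutativeRing D) ι
    (λ {x} {y} → ι-cong {x} {y}) ι-1 ι-+ ι-*

-- Specialisation to rational functions and to fractions of power series

module ConcreteFormulas where

  module _ where
    open RationalFunctions

    narayanaFromP : Identities.NarayanaFromP _≈_ _+_ _-_ _*_ 0# 1# _^_ _÷_[_] Narayana P⁽ᵖᵏ,ᵈᵉˢ⁾
    narayanaFromP = FractionFormulas.narayanaFromP ℚ[y,t]

  module _ where
    open PowerSeriesFractions
    open Fractions ℚ[y]⟦t⟧ using (numerator)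

    pFromNarayana : Identities.PFromNarayana _≈_ _+_ _-_ _*_ 0# 1# _^_ _÷_[_] Narayana P⁽ᵖᵏ,ᵈᵉˢ⁾
      (IntegralDomain.commutativeRing ℚ[y]⟦t⟧) ι
    pFromNarayana = FractionFormulas.pFromNarayana ℚ[y]⟦t⟧

    open Identities _≈_ _+_ _-_ _*_ 0# 1# _^_ _÷_[_] Narayana P⁽ᵖᵏ,ᵈᵉˢ⁾
      using (ExpressionU; ExpressionV)

    u-expression : ExpressionU 2# y t √Δ u
    u-expression = record { denominator≉0 = 2[1-y]t≉0 ; equation = ≡.refl }

    v-expression : ExpressionV 2# y t √Δ v
    v-expression = record { denominator≉0 = 2yt≉0 ; equation = ≡.refl }

    2≉0 : ¬ 2# ≈ 0#
    2≉0 p = contradiction (p 0 0) λ ()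

    1+t≉0 : ¬ 1# + t ≈ 0#
    1+t≉0 p = contradiction (p 0 0) λ ()

    P≈Narayana : ∀ n → P⁽ᵖᵏ,ᵈᵉˢ⁾ (Av231 (suc n)) y t ≈
      ((1# + u) ÷ (1# + u * v) [ 1+uv≉0 ]) ^ (suc n ℕ.+ 1) * Narayana (suc n) v
    P≈Narayana n = Identities.PFromNarayana.formula pFromNarayana {2#} {y} {t} {√Δ} {u} {v}
      (numerator y) (numerator t) (√ Δ) n ≡.refl ≡.refl ≡.refl ≡.refl √Δ-square
      2≉0 1+t≉0 u-expression v-expression 1+uv≉0

corollary5p3 : (n : ℕ) → n ≥ 1 →
    (let open RationalFunctions in
    Narayana n t ≈
    ((1# + y * t) ÷ (1# + y) [ 1+y≉0 ]) ^ (n ℕ.+ 1)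
    * P⁽ᵖᵏ,ᵈᵉˢ⁾ (Av231 n)
    (((1# + y) ^ 2 * t) ÷ ((y + t) * (1# + y * t)) [ [y+t][1+yt]≉0 ])
    ((y + t) ÷ (1# + y * t) [ 1+yt≉0 ]))
    ×
    (let open PowerSeriesFractions in
    P⁽ᵖᵏ,ᵈᵉˢ⁾ (Av231 n) y t ≈
    ((1# + u) ÷ (1# + u * v) [ 1+uv≉0 ]) ^ (n ℕ.+ 1) * Narayana n v)
corollary5p3 (suc n) _ =
  (let open RationalFunctions
   in Identities.NarayanaFromP.formula ConcreteFormulas.narayanaFromP
        y t n 1+y≉0 1+yt≉0 [y+t][1+yt]≉0) ,
  ConcreteFormulas.P≈Narayana n
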